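{- (a) For every $K_3N$ $n=pqr$, $B<2p-\sqrt{p-\frac34}+\dfrac{\sqrt3+1}{2\sqrt3}$. (b) For every $C_3N$ $n=pqr$, $B<2p-\sqrt{p-\frac34}+\dfrac{\sqrt7+1}{2\sqrt7}$.
   Context: A $K_3N$ (Korselt number with three factors) is an integer $n$ together with a factorisation $n=pqr$, where $1<p<q<r$ are odd integers (not necessarily prime) such that each of $p-1,\ q-1,\ r-1$ divides $n-1$, and such that $E:=\dfrac{pq-1}{r-1}$ (which is an integer by the divisibility condition) satisfies $E\ge 2$. A $C_3N$ is a Carmichael number with exactly three prime factors $p<q<r$, i.e. a $K_3N$ $n=pqr$ in which $p,q,r$ are all prime. Put $H:=\gcd(p-1,q-1,r-1)$ and $B:=\frac{q-1}{H}$. -}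

module Defs where

open import Data.Empty using (⊥; ⊥-elim)
import Data.Integer as ℤ
import Data.Integer.Properties as ℤ
open import Data.Nat as ℕ using (ℕ; zero; suc; _∸_)
open import Data.Nat.Divisibility
  using (_∣_; _∤_; quotient; ∣-trans; ∣m+n∣m⇒∣n; n∣m*n)
open import Data.Nat.GCD using (gcd; gcd[m,n]∣m; gcd[m,n]∣n)
open import Data.Nat.Primality using (Prime)
import Data.Nat.Properties as ℕ
open import Data.Product using (∃; ∃₂; ∃-syntax; _×_; _,_; proj₁; proj₂)
import Data.Rational
open import Data.Rational as ℚ
  using (ℚ; mkℚ; 0ℚ; 1ℚ; ½; *≤*; positive; nonNegative; nonPositive)
import Data.Rational.Properties as ℚ
open import Data.Rational.Solver using (module +-*-Solver)
import Data.Rational.Unnormalised as ℚᵘ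
import Data.Rational.Unnormalised.Properties as ℚᵘ
open import Data.Sum using (_⊎_; inj₁; inj₂)
open import Relation.Binary.Definitions using (tri<; tri≈; tri>)
open import Relation.Binary.PropositionalEquality
open import Relation.Nullary using (¬_; Dec; yes; no)

module RationalLemmas where
  open Data.Rational using (_+_; _*_; _-_; -_; _<_; _≤_)

  *-monoʳ : ∀ {r p q} → 0ℚ < r → p < q → r * p < r * q
  *-monoʳ {r} 0<r = ℚ.*-monoʳ-<-pos r {{positive 0<r}}

  *-monoˡ : ∀ {r p q} → 0ℚ < r → p < q → p * r < q * r
  *-monoˡ {r} 0<r = ℚ.*-monoˡ-<-pos r {{positive 0<r}}

  *-cancelʳ : ∀ {r p q} → 0ℚ < r → p * r < q * r → p < q
  *-cancelʳ {r} 0<r =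
    ℚ.*-cancelʳ-<-nonNeg r {{nonNegative (ℚ.<⇒≤ 0<r)}}

  *-pos : ∀ {p q} → 0ℚ < p → 0ℚ < q → 0ℚ < p * q
  *-pos {p} {q} 0<p 0<q = subst (_< p * q) (ℚ.*-zeroʳ p) (*-monoʳ 0<p 0<q)

  +-pos : ∀ {p q} → 0ℚ < p → 0ℚ < q → 0ℚ < p + q
  +-pos {p} {q} 0<p 0<q = subst (_< p + q) (ℚ.+-identityˡ 0ℚ) (ℚ.+-mono-< 0<p 0<q)

  <⇒0<- : ∀ {p q} → p < q → 0ℚ < q - p
  <⇒0<- {p} {q} p<q =
    subst (_< q - p) (ℚ.+-inverseʳ p) (ℚ.+-monoˡ-< (- p) p<q)

  0<-⇒< : ∀ {p q} → 0ℚ < q - p → p < q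
  0<-⇒< {p} {q} 0<q-p = subst₂ _<_ (ℚ.+-identityˡ p)
    (solve 2 (λ p q → (q :+ (:- p)) :+ p := q) refl p q)
    (ℚ.+-monoˡ-< p 0<q-p)
    where open +-*-Solver

  neg-involutive : ∀ p → - (- p) ≡ p
  neg-involutive = solve 1 (λ p → :- (:- p) := p) refl
    where open +-*-Solver

  0<1 : 0ℚ < 1ℚ
  0<1 = ℚ.positive⁻¹ 1ℚ

  p<p+1 : ∀ p → p < p + 1ℚ
  p<p+1 p = subst (_< p + 1ℚ) (ℚ.+-identityʳ p) (ℚ.+-monoʳ-< p 0<1)

  p<p+q : ∀ p {q} → 0ℚ < q → p < p + q
  p<p+q p {q} 0<q = subst (_< p + q) (ℚ.+-identityʳ p) (ℚ.+-monoʳ-< p 0<q)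

  p-1<p : ∀ p → p - 1ℚ < p
  p-1<p p = subst (p - 1ℚ <_) (ℚ.+-identityʳ p)
    (ℚ.+-monoʳ-< p (ℚ.negative⁻¹ (- 1ℚ)))

  squares-< : ∀ {p q} → 0ℚ ≤ p → p < q → p * p < q * q
  squares-< {p} 0≤p p<q = ℚ.≤-<-trans
    (ℚ.*-monoˡ-≤-nonNeg p {{nonNegative 0≤p}} (ℚ.<⇒≤ p<q))
    (*-monoˡ (ℚ.≤-<-trans 0≤p p<q) p<q)

  abstract
    reciprocal : ∀ {p} → 0ℚ < p → ∃[ i ] 0ℚ < i × p * i ≡ 1ℚ
    reciprocal {p} 0<p =
      ℚ.1/_ p {{nz}} ,
      ℚ.positive⁻¹ _ {{ℚ.1/pos⇒pos p {{positive 0<p}}}} ,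
      ℚ.*-inverseʳ p {{nz}}
      where nz : ℚ.NonZero p
            nz = ℚ.pos⇒nonZero p {{positive 0<p}}

    divide : ∀ q {p} → 0ℚ < p → ∃[ t ] t * p ≡ q
    divide q {p} 0<p with reciprocal 0<p
    ... | i , _ , p*i≡1 = q * i , (begin
      q * i * p    ≡⟨ solve 3 (λ q i p → q :* i :* p := q :* (p :* i)) refl q i p ⟩
      q * (p * i)  ≡⟨ cong (q *_) p*i≡1 ⟩
      q * 1ℚ       ≡⟨ ℚ.*-identityʳ q ⟩
      q            ∎)
      where open ≡-Reasoning
            open +-*-Solver

  factor-pos : ∀ {t p q} → 0ℚ < p → t * p ≡ q → 0ℚ < q → 0ℚ < t
  factor-pos {t} {p} 0<p t*p≡q 0<q =
    *-cancelʳ 0<p (subst₂ _<_ (sym (ℚ.*-zeroˡ p)) (sym t*p≡q) 0<q)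

  half : ∀ p → ½ * p + ½ * p ≡ p
  half p = begin
    ½ * p + ½ * p  ≡⟨ ℚ.*-distribʳ-+ p ½ ½ ⟨
    1ℚ * p         ≡⟨ ℚ.*-identityˡ p ⟩
    p              ∎
    where open ≡-Reasoning

  0<½* : ∀ {p} → 0ℚ < p → 0ℚ < ½ * p
  0<½* = *-pos (ℚ.positive⁻¹ ½)

  infixr 8 _·_
  _·_ : ℕ → ℚ → ℚ
  zero  · p = 0ℚ
  suc n · p = p + n · p

  ·≡* : ∀ n p → n · p ≡ (n · 1ℚ) * p
  ·≡* zero    p = sym (ℚ.*-zeroˡ p)
  ·≡* (suc n) p = begin
    p + n · p               ≡⟨ cong₂ _+_ (sym (ℚ.*-identityˡ p)) (·≡* n p) ⟩
    1ℚ * p + (n · 1ℚ) * p   ≡⟨ ℚ.*-distribʳ-+ p 1ℚ (n · 1ℚ) ⟨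
    (1ℚ + n · 1ℚ) * p       ∎
    where open ≡-Reasoning

  toℚᵘ-·1 : ∀ n → ℚ.toℚᵘ (n · 1ℚ) ℚᵘ.≃ ℚᵘ.mkℚᵘ (ℤ.+ n) 0
  toℚᵘ-·1 zero    = ℚᵘ.*≡* refl
  toℚᵘ-·1 (suc n) = ℚᵘ.≃-trans (ℚ.toℚᵘ-homo-+ 1ℚ (n · 1ℚ))
    (ℚᵘ.≃-trans (ℚᵘ.+-congʳ ℚᵘ.1ℚᵘ (toℚᵘ-·1 n)) (ℚᵘ.*≡* eq))
    where
    eq : (ℤ.1ℤ ℤ.* ℤ.1ℤ ℤ.+ ℤ.+ n ℤ.* ℤ.1ℤ) ℤ.* ℤ.1ℤ ≡ ℤ.+ suc n ℤ.* ℤ.1ℤ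
    eq = cong (ℤ._* ℤ.1ℤ) (cong (ℤ._+_ ℤ.1ℤ) (ℤ.*-identityʳ (ℤ.+ n)))

  ≤·1 : ∀ p → p ≤ ℤ.∣ ℚ.↥ p ∣ · 1ℚ
  ≤·1 p@(mkℚ i d _) = ℚ.toℚᵘ-cancel-≤
    (ℚᵘ.≤-respʳ-≃ (ℚᵘ.≃-sym (toℚᵘ-·1 ℤ.∣ i ∣)) (ℚᵘ.*≤* (bound i)))
    where
    bound : ∀ i → i ℤ.* ℤ.1ℤ ℤ.≤ ℤ.+ ℤ.∣ i ∣ ℤ.* ℤ.+ suc d
    bound i = ℤ.≤-trans (ℤ.≤-reflexive (ℤ.*-identityʳ i))
      (ℤ.≤-trans (i≤∣i∣ i)
        (subst (ℤ.+ ℤ.∣ i ∣ ℤ.≤_) (ℤ.pos-* ℤ.∣ i ∣ (suc d))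
          (ℤ.+≤+ (ℕ.m≤m*n ℤ.∣ i ∣ (suc d)))))
      where
      i≤∣i∣ : ∀ i → i ℤ.≤ ℤ.+ ℤ.∣ i ∣
      i≤∣i∣ (ℤ.+ _)      = ℤ.≤-refl
      i≤∣i∣ ℤ.-[1+ _ ] = ℤ.-≤+

  archimedean : ∀ q {p} → 0ℚ < p → ∃[ n ] q ≤ n · p
  archimedean q {p} 0<p = let t , t*p≡q = divide q 0<p in ℤ.∣ ℚ.↥ t ∣ , bound t t*p≡q
    where
    bound : ∀ t → t * p ≡ q → q ≤ ℤ.∣ ℚ.↥ t ∣ · p
    bound t t*p≡q = begin
      q                           ≡⟨ t*p≡q ⟨
      t * p                       ≤⟨ ℚ.*-monoʳ-≤-nonNeg p {{nonNegative (ℚ.<⇒≤ 0<p)}} (≤·1 t) ⟩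
      (ℤ.∣ ℚ.↥ t ∣ · 1ℚ) * p      ≡⟨ ·≡* ℤ.∣ ℚ.↥ t ∣ p ⟨
      ℤ.∣ ℚ.↥ t ∣ · p             ∎
      where open ℚ.≤-Reasoning

  p≤∣p∣ : ∀ p → p ≤ ℚ.∣ p ∣
  p≤∣p∣ p with ℚ.≤-total 0ℚ p
  ... | inj₁ 0≤p = ℚ.≤-reflexive (sym (ℚ.0≤p⇒∣p∣≡p 0≤p))
  ... | inj₂ p≤0 = ℚ.≤-trans p≤0 (ℚ.0≤∣p∣ p)

  ∣∣-< : ∀ {p q} → p < q → - p < q → ℚ.∣ p ∣ < q
  ∣∣-< {p} {q} p<q -p<q with ℚ.∣p∣≡p∨∣p∣≡-p p
  ... | inj₁ eq = subst (_< q) (sym eq) p<q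
  ... | inj₂ eq = subst (_< q) (sym eq) -p<q

  between-linear-> : ∀ {q e c d f} → q < e * c → q < e * d → c ≤ f → f ≤ d → q < e * f
  between-linear-> {e = e} q<ec q<ed c≤f f≤d with ℚ.≤-total 0ℚ e
  ... | inj₁ 0≤e = ℚ.<-≤-trans q<ec (ℚ.*-monoˡ-≤-nonNeg e {{nonNegative 0≤e}} c≤f)
  ... | inj₂ e≤0 = ℚ.<-≤-trans q<ed (ℚ.*-monoˡ-≤-nonPos e {{nonPositive e≤0}} f≤d)

  between-linear-< : ∀ {q e c d f} → e * c < q → e * d < q → c ≤ f → f ≤ d → e * f < q
  between-linear-< {e = e} ec<q ed<q c≤f f≤d with ℚ.≤-total 0ℚ e
  ... | inj₁ 0≤e = ℚ.≤-<-trans (ℚ.*-monoˡ-≤-nonNeg e {{nonNegative 0≤e}} f≤d) ed<q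
  ... | inj₂ e≤0 = ℚ.≤-<-trans (ℚ.*-monoˡ-≤-nonPos e {{nonPositive e≤0}} c≤f) ec<q

open RationalLemmas

Corners : (ℚ → Set) → (a b c d : ℚ) → Set
Corners P a b c d = P (a ℚ.* c) × P (a ℚ.* d) × P (b ℚ.* c) × P (b ℚ.* d)

module CornerLemmas where
  open Data.Rational using (_*_; _-_)

  map-corners : ∀ {P Q : ℚ → Set} {a b c d} → (∀ {s} → P s → Q s) →
                Corners P a b c d → Corners Q a b c d
  map-corners f (u , v , w , z) = f u , f v , f w , f z

  corners-rounded-> : ∀ {q a b c d} → Corners (q ℚ.<_) a b c d →
                      ∃[ r ] q ℚ.< r × Corners (r ℚ.<_) a b c d
  corners-rounded-> (h₁ , h₂ , h₃ , h₄)
    with ℚ.<-dense h₁ | ℚ.<-dense h₂ | ℚ.<-dense h₃ | ℚ.<-dense h₄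
  ... | r₁ , q<r₁ , r₁<ac | r₂ , q<r₂ , r₂<ad | r₃ , q<r₃ , r₃<bc | r₄ , q<r₄ , r₄<bd =
    m , glb (glb q<r₁ q<r₂) (glb q<r₃ q<r₄) ,
    ℚ.≤-<-trans (ℚ.≤-trans (ℚ.p⊓q≤p (r₁ ℚ.⊓ r₂) (r₃ ℚ.⊓ r₄)) (ℚ.p⊓q≤p r₁ r₂)) r₁<ac ,
    ℚ.≤-<-trans (ℚ.≤-trans (ℚ.p⊓q≤p (r₁ ℚ.⊓ r₂) (r₃ ℚ.⊓ r₄)) (ℚ.p⊓q≤q r₁ r₂)) r₂<ad ,
    ℚ.≤-<-trans (ℚ.≤-trans (ℚ.p⊓q≤q (r₁ ℚ.⊓ r₂) (r₃ ℚ.⊓ r₄)) (ℚ.p⊓q≤p r₃ r₄)) r₃<bc ,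
    ℚ.≤-<-trans (ℚ.≤-trans (ℚ.p⊓q≤q (r₁ ℚ.⊓ r₂) (r₃ ℚ.⊓ r₄)) (ℚ.p⊓q≤q r₃ r₄)) r₄<bd
    where
    m = (r₁ ℚ.⊓ r₂) ℚ.⊓ (r₃ ℚ.⊓ r₄)
    glb : ∀ {q s t} → q ℚ.< s → q ℚ.< t → q ℚ.< s ℚ.⊓ t
    glb {q} {s} {t} q<s q<t with ℚ.⊓-sel s t
    ... | inj₁ eq = subst (q ℚ.<_) (sym eq) q<s
    ... | inj₂ eq = subst (q ℚ.<_) (sym eq) q<t

  corners-rounded-< : ∀ {r a b c d} → Corners (ℚ._< r) a b c d →
                      ∃[ q ] q ℚ.< r × Corners (ℚ._< q) a b c d
  corners-rounded-< (h₁ , h₂ , h₃ , h₄)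
    with ℚ.<-dense h₁ | ℚ.<-dense h₂ | ℚ.<-dense h₃ | ℚ.<-dense h₄
  ... | r₁ , ac<r₁ , r₁<r | r₂ , ad<r₂ , r₂<r | r₃ , bc<r₃ , r₃<r | r₄ , bd<r₄ , r₄<r =
    m , lub (lub r₁<r r₂<r) (lub r₃<r r₄<r) ,
    ℚ.<-≤-trans ac<r₁ (ℚ.≤-trans (ℚ.p≤p⊔q r₁ r₂) (ℚ.p≤p⊔q (r₁ ℚ.⊔ r₂) (r₃ ℚ.⊔ r₄))) ,
    ℚ.<-≤-trans ad<r₂ (ℚ.≤-trans (ℚ.p≤q⊔p r₁ r₂) (ℚ.p≤p⊔q (r₁ ℚ.⊔ r₂) (r₃ ℚ.⊔ r₄))) ,
    ℚ.<-≤-trans bc<r₃ (ℚ.≤-trans (ℚ.p≤p⊔q r₃ r₄) (ℚ.p≤q⊔p (r₁ ℚ.⊔ r₂) (r₃ ℚ.⊔ r₄))) ,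
    ℚ.<-≤-trans bd<r₄ (ℚ.≤-trans (ℚ.p≤q⊔p r₃ r₄) (ℚ.p≤q⊔p (r₁ ℚ.⊔ r₂) (r₃ ℚ.⊔ r₄)))
    where
    m = (r₁ ℚ.⊔ r₂) ℚ.⊔ (r₃ ℚ.⊔ r₄)
    lub : ∀ {q s t} → s ℚ.< q → t ℚ.< q → s ℚ.⊔ t ℚ.< q
    lub {q} {s} {t} s<q t<q with ℚ.⊔-sel s t
    ... | inj₁ eq = subst (ℚ._< q) (sym eq) s<q
    ... | inj₂ eq = subst (ℚ._< q) (sym eq) t<q

  inside-> : ∀ {q a b c d e f} → Corners (q ℚ.<_) a b c d →
             a ℚ.≤ e → e ℚ.≤ b → c ℚ.≤ f → f ℚ.≤ d → q ℚ.< e * f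
  inside-> {q} {a} {b} {c} {d} {e} {f} (h₁ , h₂ , h₃ , h₄) a≤e e≤b c≤f f≤d =
    between-linear-> {q} {e} {c} {d} {f} (edge c h₁ h₃) (edge d h₂ h₄) c≤f f≤d
    where
    edge : ∀ c → q ℚ.< a * c → q ℚ.< b * c → q ℚ.< e * c
    edge c q<ac q<bc = subst (q ℚ.<_) (ℚ.*-comm c e)
      (between-linear-> {q} {c} {a} {b} {e} (subst (q ℚ.<_) (ℚ.*-comm a c) q<ac)
                        (subst (q ℚ.<_) (ℚ.*-comm b c) q<bc) a≤e e≤b)

  inside-< : ∀ {q a b c d e f} → Corners (ℚ._< q) a b c d →
             a ℚ.≤ e → e ℚ.≤ b → c ℚ.≤ f → f ℚ.≤ d → e * f ℚ.< q
  inside-< {q} {a} {b} {c} {d} {e} {f} (h₁ , h₂ , h₃ , h₄) a≤e e≤b c≤f f≤d =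
    between-linear-< {q} {e} {c} {d} {f} (edge c h₁ h₃) (edge d h₂ h₄) c≤f f≤d
    where
    edge : ∀ c → a * c ℚ.< q → b * c ℚ.< q → e * c ℚ.< q
    edge c ac<q bc<q = subst (ℚ._< q) (ℚ.*-comm c e)
      (between-linear-< {q} {c} {a} {b} {e} (subst (ℚ._< q) (ℚ.*-comm a c) ac<q)
                        (subst (ℚ._< q) (ℚ.*-comm b c) bc<q) a≤e e≤b)

  record In (a b s : ℚ) : Set where
    constructor _,_
    field
      a≤s : a ℚ.≤ s
      s≤b : s ℚ.≤ b

  distance : ∀ {a b δ s t} → b ℚ.< a ℚ.+ δ → In a b s → In a b t → ℚ.∣ s - t ∣ ℚ.< δ
  distance {a} {b} {δ} {s} {t} b<a+δ s∈ t∈ =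
    ∣∣-< (oneside s∈ t∈)
      (subst (ℚ._< δ) (solve 2 (λ s t → t :+ (:- s) := :- (s :+ (:- t))) refl s t)
        (oneside t∈ s∈))
    where
    open +-*-Solver
    oneside : ∀ {s t} → In a b s → In a b t → s - t ℚ.< δ
    oneside {s} {t} (_ , s≤b) (a≤t , _) = begin-strict
      s - t               ≤⟨ ℚ.+-mono-≤ s≤b (ℚ.neg-antimono-≤ a≤t) ⟩
      b - a               <⟨ ℚ.+-monoˡ-< (ℚ.- a) b<a+δ ⟩
      (a ℚ.+ δ) - a       ≡⟨ solve 2 (λ a δ → (a :+ δ) :+ (:- a) := δ) refl a δ ⟩
      δ                   ∎
      where open ℚ.≤-Reasoning

  magnitude : ∀ {a b s} → In a b s → ℚ.∣ s ∣ ℚ.≤ ℚ.∣ a ∣ ℚ.+ ℚ.∣ b ∣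
  magnitude {a} {b} {s} (a≤s , s≤b) with ℚ.∣p∣≡p∨∣p∣≡-p s
  ... | inj₁ eq = begin
    ℚ.∣ s ∣             ≡⟨ eq ⟩
    s                   ≤⟨ s≤b ⟩
    b                   ≤⟨ p≤∣p∣ b ⟩
    ℚ.∣ b ∣             ≡⟨ ℚ.+-identityˡ ℚ.∣ b ∣ ⟨
    0ℚ ℚ.+ ℚ.∣ b ∣      ≤⟨ ℚ.+-monoˡ-≤ ℚ.∣ b ∣ (ℚ.0≤∣p∣ a) ⟩
    ℚ.∣ a ∣ ℚ.+ ℚ.∣ b ∣ ∎
    where open ℚ.≤-Reasoning
  ... | inj₂ eq = begin
    ℚ.∣ s ∣             ≡⟨ eq ⟩
    ℚ.- s               ≤⟨ ℚ.neg-antimono-≤ a≤s ⟩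
    ℚ.- a               ≤⟨ p≤∣p∣ (ℚ.- a) ⟩
    ℚ.∣ ℚ.- a ∣         ≡⟨ ℚ.∣-p∣≡∣p∣ a ⟩
    ℚ.∣ a ∣             ≡⟨ ℚ.+-identityʳ ℚ.∣ a ∣ ⟨
    ℚ.∣ a ∣ ℚ.+ 0ℚ      ≤⟨ ℚ.+-monoʳ-≤ ℚ.∣ a ∣ (ℚ.0≤∣p∣ b) ⟩
    ℚ.∣ a ∣ ℚ.+ ℚ.∣ b ∣ ∎
    where open ℚ.≤-Reasoning

  product-distance : ∀ {M δ s t s′ t′} → 0ℚ ℚ.< M →
    ℚ.∣ s′ ∣ ℚ.≤ M → ℚ.∣ t ∣ ℚ.≤ M → ℚ.∣ s′ - s ∣ ℚ.< δ → ℚ.∣ t′ - t ∣ ℚ.< δ →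
    s′ * t′ ℚ.< s * t ℚ.+ (M * δ ℚ.+ M * δ)
  product-distance {M} {δ} {s} {t} {s′} {t′} 0<M s′≤M t≤M ss′ tt′ = begin-strict
    s′ * t′
      ≡⟨ solve 4 (λ s t s′ t′ → s′ :* t′ :=
           s :* t :+ (s′ :* (t′ :+ (:- t)) :+ t :* (s′ :+ (:- s)))) refl s t s′ t′ ⟩
    s * t ℚ.+ (s′ * (t′ - t) ℚ.+ t * (s′ - s))
      <⟨ ℚ.+-monoʳ-< (s * t) (ℚ.+-mono-< (bound s′≤M tt′) (bound t≤M ss′)) ⟩
    s * t ℚ.+ (M * δ ℚ.+ M * δ) ∎
    where
    open ℚ.≤-Reasoning
    open +-*-Solver
    bound : ∀ {u v} → ℚ.∣ u ∣ ℚ.≤ M → ℚ.∣ v ∣ ℚ.< δ → u * v ℚ.< M * δ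
    bound {u} {v} u≤M v<δ = begin-strict
      u * v                ≤⟨ p≤∣p∣ (u * v) ⟩
      ℚ.∣ u * v ∣          ≡⟨ ℚ.∣p*q∣≡∣p∣*∣q∣ u v ⟩
      ℚ.∣ u ∣ * ℚ.∣ v ∣    ≤⟨ ℚ.*-monoʳ-≤-nonNeg ℚ.∣ v ∣ {{ℚ.∣-∣-nonNeg v}} u≤M ⟩
      M * ℚ.∣ v ∣          <⟨ *-monoʳ 0<M v<δ ⟩
      M * δ                ∎

open CornerLemmas

module SquareRootLemmas where
  open Data.Rational using (_*_; _-_)

  abstract
    larger-root : ∀ {q s} → 0ℚ ℚ.≤ q → q * q ℚ.< s → ∃[ r ] q ℚ.< r × r * r ℚ.< s
    larger-root {q} {s} 0≤q q²<s =
      let t , tc≡s-q² = divide (s - q * q) 0<c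
          δ , 0<δ , δ<m = ℚ.<-dense (0<⊓1 {t} (factor-pos {t} 0<c tc≡s-q² (<⇒0<- q²<s)))
      in q ℚ.+ δ , p<p+q q 0<δ , bound t δ tc≡s-q² 0<δ δ<m
      where
      0<c : 0ℚ ℚ.< q ℚ.+ q ℚ.+ 1ℚ
      0<c = ℚ.≤-<-trans
        (subst (ℚ._≤ q ℚ.+ q) (ℚ.+-identityˡ 0ℚ) (ℚ.+-mono-≤ 0≤q 0≤q)) (p<p+1 _)
      0<⊓1 : ∀ {t} → 0ℚ ℚ.< t → 0ℚ ℚ.< t ℚ.⊓ 1ℚ
      0<⊓1 {t} 0<t with ℚ.⊓-sel t 1ℚ
      ... | inj₁ eq = subst (0ℚ ℚ.<_) (sym eq) 0<t
      ... | inj₂ eq = subst (0ℚ ℚ.<_) (sym eq) 0<1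
      bound : ∀ t δ → t * (q ℚ.+ q ℚ.+ 1ℚ) ≡ s - q * q → 0ℚ ℚ.< δ → δ ℚ.< t ℚ.⊓ 1ℚ →
              (q ℚ.+ δ) * (q ℚ.+ δ) ℚ.< s
      bound t δ tc≡s-q² 0<δ δ<m = begin-strict
        (q ℚ.+ δ) * (q ℚ.+ δ)
          ≡⟨ solve 2 (λ q δ → (q :+ δ) :* (q :+ δ) := q :* q :+ δ :* (q :+ q :+ δ)) refl q δ ⟩
        q * q ℚ.+ δ * (q ℚ.+ q ℚ.+ δ)
          <⟨ ℚ.+-monoʳ-< (q * q) (*-monoʳ 0<δ (ℚ.+-monoʳ-< (q ℚ.+ q)
               (ℚ.<-≤-trans δ<m (ℚ.p⊓q≤q t 1ℚ)))) ⟩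
        q * q ℚ.+ δ * (q ℚ.+ q ℚ.+ 1ℚ)
          <⟨ ℚ.+-monoʳ-< (q * q) (*-monoˡ 0<c (ℚ.<-≤-trans δ<m (ℚ.p⊓q≤p t 1ℚ))) ⟩
        q * q ℚ.+ t * (q ℚ.+ q ℚ.+ 1ℚ)
          ≡⟨ cong (q * q ℚ.+_) tc≡s-q² ⟩
        q * q ℚ.+ (s - q * q)
          ≡⟨ solve 2 (λ q s → q :* q :+ (s :+ (:- (q :* q))) := s) refl q s ⟩
        s ∎
        where
        open ℚ.≤-Reasoning
        open +-*-Solver

    -- One Newton step for √s from r.
    smaller-root : ∀ {r s} → 0ℚ ℚ.< r → 0ℚ ℚ.≤ s → s ℚ.< r * r →
                   ∃[ q ] 0ℚ ℚ.< q × q ℚ.< r × s ℚ.< q * q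
    smaller-root {r} {s} 0<r 0≤s s<r² =
      let t , t[2r]≡r²-s = divide (r * r - s) 0<2r
      in r - t , 0<r-t t t[2r]≡r²-s ,
         r-t<r (factor-pos 0<2r t[2r]≡r²-s (<⇒0<- s<r²)) ,
         s<[r-t]² t t[2r]≡r²-s
      where
      open +-*-Solver
      0<2r : 0ℚ ℚ.< r ℚ.+ r
      0<2r = +-pos 0<r 0<r
      r-t<r : ∀ {t} → 0ℚ ℚ.< t → r - t ℚ.< r
      r-t<r {t} 0<t =
        subst (r - t ℚ.<_) (ℚ.+-identityʳ r) (ℚ.+-monoʳ-< r (ℚ.neg-antimono-< 0<t))
      0<r-t : ∀ t → t * (r ℚ.+ r) ≡ r * r - s → 0ℚ ℚ.< r - t
      0<r-t t t[2r]≡r²-s = factor-pos {r - t} {r ℚ.+ r} {r * r ℚ.+ s} 0<2r eq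
        (ℚ.<-≤-trans (*-pos 0<r 0<r)
          (subst (ℚ._≤ r * r ℚ.+ s) (ℚ.+-identityʳ (r * r)) (ℚ.+-monoʳ-≤ (r * r) 0≤s)))
        where
        open ≡-Reasoning
        eq : (r - t) * (r ℚ.+ r) ≡ r * r ℚ.+ s
        eq = begin
          (r - t) * (r ℚ.+ r)
            ≡⟨ solve 2 (λ r t → (r :+ (:- t)) :* (r :+ r) := r :* (r :+ r) :+ (:- (t :* (r :+ r)))) refl r t ⟩
          r * (r ℚ.+ r) - t * (r ℚ.+ r)
            ≡⟨ cong (λ z → r * (r ℚ.+ r) - z) t[2r]≡r²-s ⟩
          r * (r ℚ.+ r) - (r * r - s)
            ≡⟨ solve 2 (λ r s → r :* (r :+ r) :+ (:- (r :* r :+ (:- s))) := r :* r :+ s) refl r s ⟩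
          r * r ℚ.+ s ∎
      s<[r-t]² : ∀ t → t * (r ℚ.+ r) ≡ r * r - s → s ℚ.< (r - t) * (r - t)
      s<[r-t]² t t[2r]≡r²-s = subst (s ℚ.<_) eq (p<p+q s (*-pos 0<t 0<t))
        where
        open ≡-Reasoning
        0<t : 0ℚ ℚ.< t
        0<t = factor-pos 0<2r t[2r]≡r²-s (<⇒0<- s<r²)
        eq : s ℚ.+ t * t ≡ (r - t) * (r - t)
        eq = begin
          s ℚ.+ t * t
            ≡⟨ solve 3 (λ r s t → s :+ t :* t := r :* r :+ (:- (r :* r :+ (:- s))) :+ t :* t) refl r s t ⟩
          r * r - (r * r - s) ℚ.+ t * t
            ≡⟨ cong (λ z → r * r - z ℚ.+ t * t) t[2r]≡r²-s ⟨
          r * r - t * (r ℚ.+ r) ℚ.+ t * t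
            ≡⟨ solve 2 (λ r t → r :* r :+ (:- (t :* (r :+ r))) :+ t :* t := (r :+ (:- t)) :* (r :+ (:- t))) refl r t ⟩
          (r - t) * (r - t) ∎

open SquareRootLemmas

-- Dedekind cuts of ℚ.  Constructively a cut must also be located.
record ℝ : Set₁ where
  no-eta-equality
  field
    lower upper     : ℚ → Set
    lower-inhabited : ∃ lower
    upper-inhabited : ∃ upper
    lower-closed    : ∀ {q r} → q ℚ.< r → lower r → lower q
    upper-closed    : ∀ {q r} → q ℚ.< r → upper q → upper r
    lower-rounded   : ∀ {q} → lower q → ∃[ r ] q ℚ.< r × lower r
    upper-rounded   : ∀ {r} → upper r → ∃[ q ] q ℚ.< r × upper q
    disjoint        : ∀ {q} → lower q → upper q → ⊥
    located         : ∀ {q r} → q ℚ.< r → lower q ⊎ upper r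

open ℝ public

infix 4 _<_
_<_ : ℝ → ℝ → Set
x < y = ∃[ q ] upper x q × lower y q

lower<upper : ∀ x {a b} → lower x a → upper x b → a ℚ.< b
lower<upper x {a} {b} a<x x<b with ℚ.<-cmp a b
... | tri< a<b _ _  = a<b
... | tri≈ _ refl _ = ⊥-elim (disjoint x a<x x<b)
... | tri> _ _ b<a  = ⊥-elim (disjoint x (lower-closed x b<a a<x) x<b)

upper-⊓ : ∀ x {s t} → upper x s → upper x t → upper x (s ℚ.⊓ t)
upper-⊓ x {s} {t} x<s x<t with ℚ.⊓-sel s t
... | inj₁ eq = subst (upper x) (sym eq) x<s
... | inj₂ eq = subst (upper x) (sym eq) x<t

record Approximation (x : ℝ) (a₀ b₀ ε : ℚ) : Set where
  constructor approximation
  field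
    {a b} : ℚ
    a<x   : lower x a
    x<b   : upper x b
    a₀≤a  : a₀ ℚ.≤ a
    b≤b₀  : b ℚ.≤ b₀
    b<a+ε : b ℚ.< a ℚ.+ ε

approximate : ∀ x {a₀ b₀ ε} → lower x a₀ → upper x b₀ → 0ℚ ℚ.< ε →
              Approximation x a₀ b₀ ε
approximate x {a₀} {b₀} {ε} a₀<x x<b₀ 0<ε =
  let n , b₀-a₀≤n·δ = archimedean (b₀ ℚ.- a₀) 0<δ in
  walk n ℚ.≤-refl a₀<x
    (subst (ℚ._≤ a₀ ℚ.+ n · δ)
      (solve 2 (λ a b → a :+ (b :+ (:- a)) := b) refl a₀ b₀)
      (ℚ.+-monoʳ-≤ a₀ b₀-a₀≤n·δ))
  where
  open +-*-Solver
  δ-dense = ℚ.<-dense (0<½* 0<ε)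
  δ = proj₁ δ-dense
  0<δ = proj₁ (proj₂ δ-dense)
  2δ<ε : δ ℚ.+ δ ℚ.< ε
  2δ<ε = subst (δ ℚ.+ δ ℚ.<_) (half ε)
    (ℚ.+-mono-< (proj₂ (proj₂ δ-dense)) (proj₂ (proj₂ δ-dense)))

  walk : ∀ n {a} → a₀ ℚ.≤ a → lower x a → b₀ ℚ.≤ a ℚ.+ n · δ →
         Approximation x a₀ b₀ ε
  walk zero {a} _ a<x b₀≤a+0 = ⊥-elim
    (ℚ.<-irrefl refl (ℚ.<-≤-trans (lower<upper x a<x x<b₀)
      (subst (b₀ ℚ.≤_) (ℚ.+-identityʳ a) b₀≤a+0)))
  walk (suc n) {a} a₀≤a a<x b₀≤a+[1+n]δ
    with located x (p<p+q (a ℚ.+ δ) 0<δ)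
  ... | inj₁ a+δ<x = walk n
    (ℚ.≤-trans a₀≤a (ℚ.<⇒≤ (p<p+q a 0<δ))) a+δ<x
    (subst (b₀ ℚ.≤_) (sym (ℚ.+-assoc a δ (n · δ))) b₀≤a+[1+n]δ)
  ... | inj₂ x<a+2δ = approximation a<x (upper-⊓ x x<b₀ x<a+2δ) a₀≤a (ℚ.p⊓q≤p b₀ _)
    (ℚ.≤-<-trans (ℚ.p⊓q≤q b₀ _)
      (subst (ℚ._< a ℚ.+ ε) (sym (ℚ.+-assoc a δ δ)) (ℚ.+-monoʳ-< a 2δ<ε)))

fromℚ : ℚ → ℝ
fromℚ s .lower q = q ℚ.< s
fromℚ s .upper q = s ℚ.< q
fromℚ s .lower-inhabited = s ℚ.- 1ℚ , p-1<p s
fromℚ s .upper-inhabited = s ℚ.+ 1ℚ , p<p+1 s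
fromℚ s .lower-closed = ℚ.<-trans
fromℚ s .upper-closed q<r s<q = ℚ.<-trans s<q q<r
fromℚ s .lower-rounded = ℚ.<-dense
fromℚ s .upper-rounded s<r with ℚ.<-dense s<r
... | q , s<q , q<r = q , q<r , s<q
fromℚ s .disjoint = ℚ.<-asym
fromℚ s .located {q} {r} q<r with q ℚ.<? s
... | yes q<s = inj₁ q<s
... | no  q≮s = inj₂ (ℚ.≤-<-trans (ℚ.≮⇒≥ q≮s) q<r)

fromℕ : ℕ → ℝ
fromℕ n = fromℚ (ℤ.+ n ℚ./ 1)

infixl 6 _+_ _-_
infix  8 -_

_+_ : ℝ → ℝ → ℝ
(x + y) .lower q = ∃₂ λ a b → lower x a × lower y b × q ℚ.< a ℚ.+ b
(x + y) .upper q = ∃₂ λ a b → upper x a × upper y b × a ℚ.+ b ℚ.< q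
(x + y) .lower-inhabited with lower-inhabited x | lower-inhabited y
... | a , a<x | b , b<y = _ , a , b , a<x , b<y , p-1<p (a ℚ.+ b)
(x + y) .upper-inhabited with upper-inhabited x | upper-inhabited y
... | a , x<a | b , y<b = _ , a , b , x<a , y<b , p<p+1 (a ℚ.+ b)
(x + y) .lower-closed q<r (a , b , a<x , b<y , r<a+b) =
  a , b , a<x , b<y , ℚ.<-trans q<r r<a+b
(x + y) .upper-closed q<r (a , b , x<a , y<b , a+b<q) =
  a , b , x<a , y<b , ℚ.<-trans a+b<q q<r
(x + y) .lower-rounded (a , b , a<x , b<y , q<a+b) with ℚ.<-dense q<a+b
... | r , q<r , r<a+b = r , q<r , a , b , a<x , b<y , r<a+b
(x + y) .upper-rounded (a , b , x<a , y<b , a+b<r) with ℚ.<-dense a+b<r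
... | q , a+b<q , q<r = q , q<r , a , b , x<a , y<b , a+b<q
(x + y) .disjoint (a , b , a<x , b<y , q<a+b) (a′ , b′ , x<a′ , y<b′ , a′+b′<q) =
  ℚ.<-irrefl refl (ℚ.<-trans (ℚ.<-trans q<a+b
    (ℚ.+-mono-< (lower<upper x a<x x<a′) (lower<upper y b<y y<b′))) a′+b′<q)
(x + y) .located {q} {r} q<r = decide
  (approximate x (proj₂ (lower-inhabited x)) (proj₂ (upper-inhabited x)) 0<ε)
  (approximate y (proj₂ (lower-inhabited y)) (proj₂ (upper-inhabited y)) 0<ε)
  where
  ε = ½ ℚ.* (r ℚ.- q)
  0<ε = 0<½* (<⇒0<- q<r)
  decide : ∀ {a₀ a₁ b₀ b₁} → Approximation x a₀ a₁ ε → Approximation y b₀ b₁ ε →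
           (x + y) .lower q ⊎ (x + y) .upper r
  decide (approximation {a} {a′} a<x x<a′ _ _ a′<a+ε)
         (approximation {b} {b′} b<y y<b′ _ _ b′<b+ε)
    with q ℚ.<? a ℚ.+ b
  ... | yes q<a+b = inj₁ (a , b , a<x , b<y , q<a+b)
  ... | no  q≮a+b = inj₂ (a′ , b′ , x<a′ , y<b′ , (begin-strict
    a′ ℚ.+ b′                  <⟨ ℚ.+-mono-< a′<a+ε b′<b+ε ⟩
    (a ℚ.+ ε) ℚ.+ (b ℚ.+ ε)    ≡⟨ solve 3 (λ a b ε → (a :+ ε) :+ (b :+ ε) := (a :+ b) :+ (ε :+ ε)) refl a b ε ⟩
    (a ℚ.+ b) ℚ.+ (ε ℚ.+ ε)    ≤⟨ ℚ.+-monoˡ-≤ (ε ℚ.+ ε) (ℚ.≮⇒≥ q≮a+b) ⟩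
    q ℚ.+ (ε ℚ.+ ε)            ≡⟨ cong (q ℚ.+_) (half (r ℚ.- q)) ⟩
    q ℚ.+ (r ℚ.- q)            ≡⟨ solve 2 (λ q r → q :+ (r :+ (:- q)) := r) refl q r ⟩
    r                          ∎))
    where
    open ℚ.≤-Reasoning
    open +-*-Solver

-_ : ℝ → ℝ
(- x) .lower q = upper x (ℚ.- q)
(- x) .upper q = lower x (ℚ.- q)
(- x) .lower-inhabited with upper-inhabited x
... | b , x<b = ℚ.- b , subst (upper x) (sym (neg-involutive b)) x<b
(- x) .upper-inhabited with lower-inhabited x
... | a , a<x = ℚ.- a , subst (lower x) (sym (neg-involutive a)) a<x
(- x) .lower-closed q<r = upper-closed x (ℚ.neg-antimono-< q<r)
(- x) .upper-closed q<r = lower-closed x (ℚ.neg-antimono-< q<r)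
(- x) .lower-rounded {q} x<-q with upper-rounded x x<-q
... | b , b<-q , x<b = ℚ.- b ,
  subst (ℚ._< ℚ.- b) (neg-involutive q) (ℚ.neg-antimono-< b<-q) ,
  subst (upper x) (sym (neg-involutive b)) x<b
(- x) .upper-rounded {q} -q<x with lower-rounded x -q<x
... | a , -q<a , a<x = ℚ.- a ,
  subst (ℚ.- a ℚ.<_) (neg-involutive q) (ℚ.neg-antimono-< -q<a) ,
  subst (lower x) (sym (neg-involutive a)) a<x
(- x) .disjoint x<-q -q<x = disjoint x -q<x x<-q
(- x) .located q<r with located x (ℚ.neg-antimono-< q<r)
... | inj₁ -r<x = inj₂ -r<x
... | inj₂ x<-q = inj₁ x<-q

_-_ : ℝ → ℝ → ℝ
x - y = x + - y

infixl 7 _*_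

-- Over a rectangle a < x < b, c < y < d the extreme values of the product
-- occur at the corners.
_*_ : ℝ → ℝ → ℝ
(x * y) .lower q = ∃₂ λ a b → ∃₂ λ c d →
  lower x a × upper x b × lower y c × upper y d × Corners (q ℚ.<_) a b c d
(x * y) .upper q = ∃₂ λ a b → ∃₂ λ c d →
  lower x a × upper x b × lower y c × upper y d × Corners (ℚ._< q) a b c d
(x * y) .lower-inhabited
  with lower-inhabited x | upper-inhabited x | lower-inhabited y | upper-inhabited y
... | a , a<x | b , x<b | c , c<y | d , y<d =
  m ℚ.- 1ℚ , a , b , c , d , a<x , x<b , c<y , y<d ,
  ℚ.<-≤-trans m-1<m (ℚ.≤-trans (ℚ.p⊓q≤p (ac ℚ.⊓ ad) (bc ℚ.⊓ bd)) (ℚ.p⊓q≤p ac ad)) ,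
  ℚ.<-≤-trans m-1<m (ℚ.≤-trans (ℚ.p⊓q≤p (ac ℚ.⊓ ad) (bc ℚ.⊓ bd)) (ℚ.p⊓q≤q ac ad)) ,
  ℚ.<-≤-trans m-1<m (ℚ.≤-trans (ℚ.p⊓q≤q (ac ℚ.⊓ ad) (bc ℚ.⊓ bd)) (ℚ.p⊓q≤p bc bd)) ,
  ℚ.<-≤-trans m-1<m (ℚ.≤-trans (ℚ.p⊓q≤q (ac ℚ.⊓ ad) (bc ℚ.⊓ bd)) (ℚ.p⊓q≤q bc bd))
  where
  ac = a ℚ.* c
  ad = a ℚ.* d
  bc = b ℚ.* c
  bd = b ℚ.* d
  m = (ac ℚ.⊓ ad) ℚ.⊓ (bc ℚ.⊓ bd)
  m-1<m = p-1<p m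
(x * y) .upper-inhabited
  with lower-inhabited x | upper-inhabited x | lower-inhabited y | upper-inhabited y
... | a , a<x | b , x<b | c , c<y | d , y<d =
  m ℚ.+ 1ℚ , a , b , c , d , a<x , x<b , c<y , y<d ,
  ℚ.≤-<-trans (ℚ.≤-trans (ℚ.p≤p⊔q ac ad) (ℚ.p≤p⊔q (ac ℚ.⊔ ad) (bc ℚ.⊔ bd))) m<m+1 ,
  ℚ.≤-<-trans (ℚ.≤-trans (ℚ.p≤q⊔p ac ad) (ℚ.p≤p⊔q (ac ℚ.⊔ ad) (bc ℚ.⊔ bd))) m<m+1 ,
  ℚ.≤-<-trans (ℚ.≤-trans (ℚ.p≤p⊔q bc bd) (ℚ.p≤q⊔p (ac ℚ.⊔ ad) (bc ℚ.⊔ bd))) m<m+1 ,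
  ℚ.≤-<-trans (ℚ.≤-trans (ℚ.p≤q⊔p bc bd) (ℚ.p≤q⊔p (ac ℚ.⊔ ad) (bc ℚ.⊔ bd))) m<m+1
  where
  ac = a ℚ.* c
  ad = a ℚ.* d
  bc = b ℚ.* c
  bd = b ℚ.* d
  m = (ac ℚ.⊔ ad) ℚ.⊔ (bc ℚ.⊔ bd)
  m<m+1 = p<p+1 m
(x * y) .lower-closed q<r (a , b , c , d , a<x , x<b , c<y , y<d , h) =
  a , b , c , d , a<x , x<b , c<y , y<d , map-corners {_ ℚ.<_} {_ ℚ.<_} {a} {b} {c} {d} (ℚ.<-trans q<r) h
(x * y) .upper-closed q<r (a , b , c , d , a<x , x<b , c<y , y<d , h) =
  a , b , c , d , a<x , x<b , c<y , y<d ,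
  map-corners {ℚ._< _} {ℚ._< _} {a} {b} {c} {d} (λ s<q → ℚ.<-trans s<q q<r) h
(x * y) .lower-rounded (a , b , c , d , a<x , x<b , c<y , y<d , h)
  with corners-rounded-> {_} {a} {b} {c} {d} h
... | r , q<r , h′ = r , q<r , a , b , c , d , a<x , x<b , c<y , y<d , h′
(x * y) .upper-rounded (a , b , c , d , a<x , x<b , c<y , y<d , h)
  with corners-rounded-< {_} {a} {b} {c} {d} h
... | q , q<r , h′ = q , q<r , a , b , c , d , a<x , x<b , c<y , y<d , h′
(x * y) .disjoint (a , b , c , d , a<x , x<b , c<y , y<d , h)
                  (a′ , b′ , c′ , d′ , a′<x , x<b′ , c′<y , y<d′ , h′) =
  ℚ.<-irrefl refl (ℚ.<-trans
    (inside-> h (ℚ.p≤p⊔q a a′) (below x x<b a<x a′<x)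
                (ℚ.p≤p⊔q c c′) (below y y<d c<y c′<y))
    (inside-< h′ (ℚ.p≤q⊔p a a′) (below x x<b′ a<x a′<x)
                 (ℚ.p≤q⊔p c c′) (below y y<d′ c<y c′<y)))
  where
  below : ∀ x {a a′ b} → upper x b → lower x a → lower x a′ → a ℚ.⊔ a′ ℚ.≤ b
  below x x<b a<x a′<x =
    ℚ.⊔-lub (ℚ.<⇒≤ (lower<upper x a<x x<b)) (ℚ.<⇒≤ (lower<upper x a′<x x<b))
(x * y) .located {q} {r} q<r =
  let a₀ , a₀<x = lower-inhabited x
      b₀ , x<b₀ = upper-inhabited x
      c₀ , c₀<y = lower-inhabited y
      d₀ , y<d₀ = upper-inhabited y
      Mˣ = ℚ.∣ a₀ ∣ ℚ.+ ℚ.∣ b₀ ∣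
      Mʸ = ℚ.∣ c₀ ∣ ℚ.+ ℚ.∣ d₀ ∣
      M = (Mˣ ℚ.⊔ Mʸ) ℚ.+ 1ℚ
      Mˣ<M = ℚ.≤-<-trans (ℚ.p≤p⊔q Mˣ Mʸ) (p<p+1 (Mˣ ℚ.⊔ Mʸ))
      Mʸ<M = ℚ.≤-<-trans (ℚ.p≤q⊔p Mˣ Mʸ) (p<p+1 (Mˣ ℚ.⊔ Mʸ))
      0<M = ℚ.≤-<-trans (0≤∣∣+∣∣ a₀ b₀) Mˣ<M
      δ , δM≡½[r-q] = divide (½ ℚ.* (r ℚ.- q)) 0<M
      0<δ = factor-pos 0<M δM≡½[r-q] (0<½* (<⇒0<- q<r))
  in decide M δ 0<M (ℚ.<⇒≤ Mˣ<M) (ℚ.<⇒≤ Mʸ<M) (q+2Mδ≡r M δ δM≡½[r-q])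
       (approximate x a₀<x x<b₀ 0<δ) (approximate y c₀<y y<d₀ 0<δ)
  where
  0≤∣∣+∣∣ : ∀ a b → 0ℚ ℚ.≤ ℚ.∣ a ∣ ℚ.+ ℚ.∣ b ∣
  0≤∣∣+∣∣ a b = subst (ℚ._≤ ℚ.∣ a ∣ ℚ.+ ℚ.∣ b ∣) (ℚ.+-identityˡ 0ℚ)
    (ℚ.+-mono-≤ (ℚ.0≤∣p∣ a) (ℚ.0≤∣p∣ b))

  q+2Mδ≡r : ∀ M δ → δ ℚ.* M ≡ ½ ℚ.* (r ℚ.- q) → q ℚ.+ (M ℚ.* δ ℚ.+ M ℚ.* δ) ≡ r
  q+2Mδ≡r M δ δM≡½[r-q] = begin
    q ℚ.+ (M ℚ.* δ ℚ.+ M ℚ.* δ)  ≡⟨ cong (λ t → q ℚ.+ (t ℚ.+ t)) (trans (ℚ.*-comm M δ) δM≡½[r-q]) ⟩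
    _                            ≡⟨ cong (q ℚ.+_) (half (r ℚ.- q)) ⟩
    q ℚ.+ (r ℚ.- q)              ≡⟨ solve 2 (λ q r → q :+ (r :+ (:- q)) := r) refl q r ⟩
    r                            ∎
    where open ≡-Reasoning
          open +-*-Solver

  decide : ∀ M δ {a₀ b₀ c₀ d₀} → 0ℚ ℚ.< M →
           ℚ.∣ a₀ ∣ ℚ.+ ℚ.∣ b₀ ∣ ℚ.≤ M → ℚ.∣ c₀ ∣ ℚ.+ ℚ.∣ d₀ ∣ ℚ.≤ M →
           q ℚ.+ (M ℚ.* δ ℚ.+ M ℚ.* δ) ≡ r →
           Approximation x a₀ b₀ δ → Approximation y c₀ d₀ δ →
           (x * y) .lower q ⊎ (x * y) .upper r
  decide M δ 0<M Mˣ≤M Mʸ≤M q+2Mδ≡r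
         (approximation {a} {b} a<x x<b a₀≤a b≤b₀ b<a+δ)
         (approximation {c} {d} c<y y<d c₀≤c d≤d₀ d<c+δ) =
    cases (q ℚ.<? a ℚ.* c) (q ℚ.<? a ℚ.* d) (q ℚ.<? b ℚ.* c) (q ℚ.<? b ℚ.* d)
    where
    near : ∀ {s s′ t t′} → ¬ (q ℚ.< s ℚ.* t) → In a b s → In a b s′ → In c d t → In c d t′ →
           s′ ℚ.* t′ ℚ.< r
    near {s} {s′} {t} {t′} q≮st s∈ s′∈@(a≤s′ , s′≤b) t∈@(c≤t , t≤d) t′∈ =
      ℚ.<-≤-trans
        (product-distance {M} {δ} {s} {t} {s′} {t′} 0<M
          (ℚ.≤-trans (magnitude (ℚ.≤-trans a₀≤a a≤s′ , ℚ.≤-trans s′≤b b≤b₀)) Mˣ≤M)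
          (ℚ.≤-trans (magnitude (ℚ.≤-trans c₀≤c c≤t , ℚ.≤-trans t≤d d≤d₀)) Mʸ≤M)
          (distance b<a+δ s′∈ s∈) (distance d<c+δ t′∈ t∈))
        (subst (s ℚ.* t ℚ.+ (M ℚ.* δ ℚ.+ M ℚ.* δ) ℚ.≤_) q+2Mδ≡r
          (ℚ.+-monoˡ-≤ (M ℚ.* δ ℚ.+ M ℚ.* δ) (ℚ.≮⇒≥ q≮st)))

    a≤b = ℚ.<⇒≤ (lower<upper x a<x x<b)
    c≤d = ℚ.<⇒≤ (lower<upper y c<y y<d)
    a∈ : In a b a
    a∈ = ℚ.≤-refl , a≤b
    b∈ : In a b b
    b∈ = a≤b , ℚ.≤-refl
    c∈ : In c d c
    c∈ = ℚ.≤-refl , c≤d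
    d∈ : In c d d
    d∈ = c≤d , ℚ.≤-refl

    above : ∀ {s t} → ¬ (q ℚ.< s ℚ.* t) → In a b s → In c d t → (x * y) .upper r
    above {s} {t} q≮st s∈ t∈ = a , b , c , d , a<x , x<b , c<y , y<d ,
      near {s} {a} {t} {c} q≮st s∈ a∈ t∈ c∈ , near {s} {a} {t} {d} q≮st s∈ a∈ t∈ d∈ ,
      near {s} {b} {t} {c} q≮st s∈ b∈ t∈ c∈ , near {s} {b} {t} {d} q≮st s∈ b∈ t∈ d∈

    cases : Dec (q ℚ.< a ℚ.* c) → Dec (q ℚ.< a ℚ.* d) →
            Dec (q ℚ.< b ℚ.* c) → Dec (q ℚ.< b ℚ.* d) →
            (x * y) .lower q ⊎ (x * y) .upper r
    cases (yes h₁) (yes h₂) (yes h₃) (yes h₄) =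
      inj₁ (a , b , c , d , a<x , x<b , c<y , y<d , h₁ , h₂ , h₃ , h₄)
    cases (no q≮ac) _ _ _ = inj₂ (above {a} {c} q≮ac a∈ c∈)
    cases _ (no q≮ad) _ _ = inj₂ (above {a} {d} q≮ad a∈ d∈)
    cases _ _ (no q≮bc) _ = inj₂ (above {b} {c} q≮bc b∈ c∈)
    cases _ _ _ (no q≮bd) = inj₂ (above {b} {d} q≮bd b∈ d∈)

record Positive (x : ℝ) : Set where
  constructor mkPositive
  field
    0<x : fromℕ 0 < x

module PositiveLemmas where
  lower-0 : ∀ x {{_ : Positive x}} → lower x 0ℚ
  lower-0 x {{mkPositive (q , 0<q , q<x)}} = lower-closed x 0<q q<x

  positive-lower : ∀ x {{_ : Positive x}} → ∃[ a ] 0ℚ ℚ.< a × lower x a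
  positive-lower x = lower-rounded x (lower-0 x)

  fromLower-0 : ∀ x → lower x 0ℚ → Positive x
  fromLower-0 x 0<x = mkPositive (lower-rounded x 0<x)

  upper-positive : ∀ x {{_ : Positive x}} {b} → upper x b → 0ℚ ℚ.< b
  upper-positive x = lower<upper x (lower-0 x)

open PositiveLemmas

infix  8 _⁻¹
infixl 7 _/_

-- For x > 0, q < 1/x iff q u < 1 for some rational u > x, whatever the sign of q.
_⁻¹ : (x : ℝ) {{_ : Positive x}} → ℝ
(x ⁻¹) .lower q = ∃[ u ] upper x u × q ℚ.* u ℚ.< 1ℚ
(x ⁻¹) .upper q = ∃[ l ] 0ℚ ℚ.< l × lower x l × 1ℚ ℚ.< q ℚ.* l
(x ⁻¹) .lower-inhabited with upper-inhabited x
... | u , x<u = 0ℚ , u , x<u , subst (ℚ._< 1ℚ) (sym (ℚ.*-zeroˡ u)) 0<1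
(x ⁻¹) .upper-inhabited with positive-lower x
... | l , 0<l , l<x with divide (1ℚ ℚ.+ 1ℚ) 0<l
... | t , t*l≡2 = t , l , 0<l , l<x , subst (1ℚ ℚ.<_) (sym t*l≡2) (p<p+1 1ℚ)
(x ⁻¹) .lower-closed q<r (u , x<u , ru<1) =
  u , x<u , ℚ.<-trans (*-monoˡ (upper-positive x x<u) q<r) ru<1
(x ⁻¹) .upper-closed q<r (l , 0<l , l<x , 1<ql) =
  l , 0<l , l<x , ℚ.<-trans 1<ql (*-monoˡ 0<l q<r)
(x ⁻¹) .lower-rounded {q} (u , x<u , qu<1) with ℚ.<-dense qu<1
... | m , qu<m , m<1 with divide m (upper-positive x x<u)
... | r , ru≡m =
  r , *-cancelʳ (upper-positive x x<u) (subst (q ℚ.* u ℚ.<_) (sym ru≡m) qu<m) ,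
  u , x<u , subst (ℚ._< 1ℚ) (sym ru≡m) m<1
(x ⁻¹) .upper-rounded {r} (l , 0<l , l<x , 1<rl) with ℚ.<-dense 1<rl
... | m , 1<m , m<rl with divide m 0<l
... | q , ql≡m =
  q , *-cancelʳ 0<l (subst (ℚ._< r ℚ.* l) (sym ql≡m) m<rl) ,
  l , 0<l , l<x , subst (1ℚ ℚ.<_) (sym ql≡m) 1<m
(x ⁻¹) .disjoint {q} (u , x<u , qu<1) (l , 0<l , l<x , 1<ql) =
  ℚ.<-asym (ℚ.<-trans 1<ql (*-monoʳ 0<q (lower<upper x l<x x<u))) qu<1
  where
  0<q : 0ℚ ℚ.< q
  0<q = *-cancelʳ 0<l (subst (ℚ._< q ℚ.* l) (sym (ℚ.*-zeroˡ l)) (ℚ.<-trans 0<1 1<ql))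
(x ⁻¹) .located {q} {r} q<r with 0ℚ ℚ.<? q
... | no 0≮q with upper-inhabited x
...   | u , x<u = inj₁ (u , x<u , ℚ.≤-<-trans
  (subst (q ℚ.* u ℚ.≤_) (ℚ.*-zeroˡ u)
    (ℚ.*-monoʳ-≤-nonNeg u {{nonNegative (ℚ.<⇒≤ (upper-positive x x<u))}} (ℚ.≮⇒≥ 0≮q))) 0<1)
(x ⁻¹) .located {q} {r} q<r | yes 0<q
  with reciprocal 0<q | reciprocal (ℚ.<-trans 0<q q<r)
... | q⁻¹ , 0<q⁻¹ , qq⁻¹≡1 | r⁻¹ , 0<r⁻¹ , rr⁻¹≡1 with located x r⁻¹<q⁻¹
  where
  r⁻¹<q⁻¹ : r⁻¹ ℚ.< q⁻¹
  r⁻¹<q⁻¹ = *-cancelʳ 0<q (subst₂ ℚ._<_ (ℚ.*-comm q r⁻¹)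
    (trans rr⁻¹≡1 (trans (sym qq⁻¹≡1) (ℚ.*-comm q q⁻¹))) (*-monoˡ 0<r⁻¹ q<r))
...   | inj₁ r⁻¹<x with lower-rounded x r⁻¹<x
...     | l , r⁻¹<l , l<x = inj₂ (l , ℚ.<-trans 0<r⁻¹ r⁻¹<l , l<x ,
  subst (ℚ._< r ℚ.* l) rr⁻¹≡1 (*-monoʳ (ℚ.<-trans 0<q q<r) r⁻¹<l))
(x ⁻¹) .located {q} {r} q<r | yes 0<q | q⁻¹ , _ , qq⁻¹≡1 | _ | inj₂ x<q⁻¹
  with upper-rounded x x<q⁻¹
...   | u , u<q⁻¹ , x<u = inj₁ (u , x<u , subst (q ℚ.* u ℚ.<_) qq⁻¹≡1 (*-monoʳ 0<q u<q⁻¹))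

_/_ : (x y : ℝ) {{_ : Positive y}} → ℝ
x / y = x * y ⁻¹

infix 8 √_

-- Total: √ x is 0 when x is negative.
√_ : ℝ → ℝ
(√ x) .lower q = q ℚ.< 0ℚ ⊎ lower x (q ℚ.* q)
(√ x) .upper q = 0ℚ ℚ.< q × upper x (q ℚ.* q)
(√ x) .lower-inhabited = 0ℚ ℚ.- 1ℚ , inj₁ (p-1<p 0ℚ)
(√ x) .upper-inhabited with upper-inhabited x
... | u , x<u = t , 0<t , upper-closed x u<t² x<u
  where
  t = ℚ.∣ u ∣ ℚ.+ 1ℚ
  ∣u∣<t = p<p+1 ℚ.∣ u ∣
  0<t = ℚ.≤-<-trans (ℚ.0≤∣p∣ u) ∣u∣<t
  1≤t : 1ℚ ℚ.≤ t
  1≤t = subst (ℚ._≤ t) (ℚ.+-identityˡ 1ℚ) (ℚ.+-monoˡ-≤ 1ℚ (ℚ.0≤∣p∣ u))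
  u<t² : u ℚ.< t ℚ.* t
  u<t² = begin-strict
    u          ≤⟨ p≤∣p∣ u ⟩
    ℚ.∣ u ∣    <⟨ ∣u∣<t ⟩
    t          ≡⟨ ℚ.*-identityʳ t ⟨
    t ℚ.* 1ℚ   ≤⟨ ℚ.*-monoˡ-≤-nonNeg t {{nonNegative (ℚ.<⇒≤ 0<t)}} 1≤t ⟩
    t ℚ.* t    ∎
    where open ℚ.≤-Reasoning
(√ x) .lower-closed q<r (inj₁ r<0) = inj₁ (ℚ.<-trans q<r r<0)
(√ x) .lower-closed {q} q<r (inj₂ r²<x) with q ℚ.<? 0ℚ
... | yes q<0 = inj₁ q<0
... | no  q≮0 = inj₂ (lower-closed x (squares-< (ℚ.≮⇒≥ q≮0) q<r) r²<x)
(√ x) .upper-closed q<r (0<q , x<q²) =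
  ℚ.<-trans 0<q q<r , upper-closed x (squares-< (ℚ.<⇒≤ 0<q) q<r) x<q²
(√ x) .lower-rounded {q} h with q ℚ.<? 0ℚ | h
... | yes q<0 | _ with ℚ.<-dense q<0
...   | r , q<r , r<0 = r , q<r , inj₁ r<0
(√ x) .lower-rounded {q} h | no q≮0 | inj₁ q<0 = ⊥-elim (q≮0 q<0)
(√ x) .lower-rounded {q} h | no q≮0 | inj₂ q²<x with lower-rounded x q²<x
... | s , q²<s , s<x with larger-root (ℚ.≮⇒≥ q≮0) q²<s
...   | r , q<r , r²<s = r , q<r , inj₂ (lower-closed x r²<s s<x)
(√ x) .upper-rounded {r} (0<r , x<r²) with upper-rounded x x<r²
... | s , s<r² , x<s with s ℚ.<? 0ℚ
...   | no s≮0 with smaller-root 0<r (ℚ.≮⇒≥ s≮0) s<r²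
...     | q , 0<q , q<r , s<q² = q , q<r , 0<q , upper-closed x s<q² x<s
(√ x) .upper-rounded {r} (0<r , x<r²) | s , s<r² , x<s | yes s<0 with ℚ.<-dense 0<r
...     | q , 0<q , q<r = q , q<r , 0<q , upper-closed x (ℚ.<-trans s<0 (*-pos 0<q 0<q)) x<s
(√ x) .disjoint (inj₁ q<0)  (0<q , _)   = ℚ.<-asym q<0 0<q
(√ x) .disjoint (inj₂ q²<x) (_ , x<q²) = disjoint x q²<x x<q²
(√ x) .located {q} q<r with q ℚ.<? 0ℚ
... | yes q<0 = inj₁ (inj₁ q<0)
... | no  q≮0 with located x (squares-< (ℚ.≮⇒≥ q≮0) q<r)
...   | inj₁ q²<x = inj₁ (inj₂ q²<x)
...   | inj₂ x<r² = inj₂ (ℚ.≤-<-trans (ℚ.≮⇒≥ q≮0) q<r , x<r²)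

instance
  fromℚ-positive : ∀ {s} {{_ : ℚ.Positive s}} → Positive (fromℚ s)
  fromℚ-positive {s} = fromLower-0 (fromℚ s) (ℚ.positive⁻¹ s)

  √-positive : ∀ {x} {{_ : Positive x}} → Positive (√ x)
  √-positive {x} = fromLower-0 (√ x) (inj₂ (lower-0 x))

  *-positive : ∀ {x y} {{_ : Positive x}} {{_ : Positive y}} → Positive (x * y)
  *-positive {x} {y} with positive-lower x | positive-lower y
                        | upper-inhabited x | upper-inhabited y
  ... | a , 0<a , a<x | c , 0<c , c<y | b , x<b | d , y<d = fromLower-0 (x * y)
    (a , b , c , d , a<x , x<b , c<y , y<d ,
     *-pos 0<a 0<c , *-pos 0<a 0<d , *-pos 0<b 0<c , *-pos 0<b 0<d)
    where
    0<b = upper-positive x x<b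
    0<d = upper-positive y y<d

r-1∣pq-1 : ∀ {n p q r} → n ≡ p ℕ.* q ℕ.* r → 1 ℕ.< p → p ℕ.< q → q ℕ.< r →
       (r ∸ 1) ∣ (n ∸ 1) → (r ∸ 1) ∣ (p ℕ.* q ∸ 1)
r-1∣pq-1 {p = suc p} {suc q} {suc r} refl _ _ _ r-1∣n-1 =
  ∣m+n∣m⇒∣n (subst (r ∣_) eq r-1∣n-1) (n∣m*n (suc p ℕ.* suc q))
  where
  m = q ℕ.+ p ℕ.* suc q
  eq : suc m ℕ.* suc r ∸ 1 ≡ suc m ℕ.* r ℕ.+ m
  eq = begin
    suc m ℕ.* suc r ∸ 1        ≡⟨ cong (_∸ 1) (ℕ.*-suc (suc m) r) ⟩
    m ℕ.+ suc m ℕ.* r          ≡⟨ ℕ.+-comm m (suc m ℕ.* r) ⟩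
    suc m ℕ.* r ℕ.+ m          ∎
    where open ≡-Reasoning

-- The subtractions are exact, since 1 < p < q < r.
record K₃N (n p q r : ℕ) : Set where
  field
    n≡pqr   : n ≡ p ℕ.* q ℕ.* r
    1<p     : 1 ℕ.< p
    p<q     : p ℕ.< q
    q<r     : q ℕ.< r
    p-odd   : 2 ∤ p
    q-odd   : 2 ∤ q
    r-odd   : 2 ∤ r
    p-1∣n-1 : (p ∸ 1) ∣ (n ∸ 1)
    q-1∣n-1 : (q ∸ 1) ∣ (n ∸ 1)
    r-1∣n-1 : (r ∸ 1) ∣ (n ∸ 1)

  E : ℕ
  E = quotient (r-1∣pq-1 n≡pqr 1<p p<q q<r r-1∣n-1)

  field
    2≤E : 2 ℕ.≤ E

record C₃N (n p q r : ℕ) : Set where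
  field
    k₃n     : K₃N n p q r
    p-prime : Prime p
    q-prime : Prime q
    r-prime : Prime r

H : (p q r : ℕ) → ℕ
H p q r = gcd (gcd (p ∸ 1) (q ∸ 1)) (r ∸ 1)

H∣q-1 : ∀ p q r → H p q r ∣ (q ∸ 1)
H∣q-1 p q r = ∣-trans (gcd[m,n]∣m (gcd (p ∸ 1) (q ∸ 1)) (r ∸ 1)) (gcd[m,n]∣n (p ∸ 1) (q ∸ 1))

B : (p q r : ℕ) → ℕ
B p q r = quotient (H∣q-1 p q r)

{-# OPTIONS --safe #-}

-- Write p = 1 + AH, q = 1 + BH, r = 1 + CH.  The divisibility conditions make A, B, C
-- pairwise coprime and give B ∣ E + p, with E < p because B < C.  If B ≠ E + p then
-- B < p and the bound is crude.  If B = E + p then A ∣ H + 1, say H + 1 = mA with m odd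
-- (H is even), so p = mA² − A + 1; and with D = p − E = 2p − B also A + D² = lE for some
-- l ≥ 1.  Hence D² + D + A ≥ p, that is (2D + 1)² ≥ 4mA² − 8A + 5, whereas the claim is,
-- with N = 3 or 7, that 2D + 1 + 1/√N > √(4p − 3) = √(4mA² − 4A + 1).  This holds when
-- N ≤ m, directly when m = 1, and also when l ≥ 2.  What remains for N = 7 is l = 1 with
-- m = 5, which is impossible modulo 9, and with m = 3, where A = 1 is harmless
-- (561 = 3·11·17 occurs here) and A > 1 forces 3 to divide p, q or r.

module Submission where

import Defs
open import Data.Empty using (⊥-elim)
import Data.Integer as ℤ
import Data.Integer.Properties as ℤ
open import Data.Nat as ℕ using (ℕ)
open import Data.Nat.Tactic.RingSolver using (solve-∀)
import Data.Nat.Properties as ℕ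
open import Data.Product using (∃-syntax; _×_; _,_; proj₁; proj₂)
import Data.Rational as ℚ
open import Data.Rational using (ℚ; 0ℚ; 1ℚ; ½; nonNegative)
import Data.Rational.Properties as ℚ
open import Data.Rational.Solver using (module +-*-Solver)
import Data.Rational.Unnormalised as ℚᵘ
import Data.Rational.Unnormalised.Properties as ℚᵘ
open import Data.Sum using (_⊎_; inj₁; inj₂; [_,_]′)
open import Relation.Binary.PropositionalEquality

module Arithmetic where
  open Defs using (K₃N; C₃N)
  open import Data.Nat
  open import Data.Nat.Coprimality as Coprimality using (Coprime; coprime-divisor)
  open import Data.Nat.Divisibility
  open import Data.Nat.DivMod using (_%_; _/_; m≡m%n+[m/n]*n; m%n<n; [m+kn]%n≡m%n)
  open import Data.Nat.GCD using (gcd; gcd[m,n]∣m; gcd[m,n]∣n; gcd-greatest)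
  open import Data.Nat.Primality using (Prime; prime⇒irreducible)
  open import Data.Nat.Properties
  open import Relation.Nullary using (¬_; contradiction)
  open import Relation.Nullary.Decidable using (from-no)

  -- Divisibility consequences of the Korselt conditions.

  ∣-sum : ∀ {d n} k {s} → d ∣ n → n ≡ k * d + s → d ∣ s
  ∣-sum k d∣n n≡kd+s = ∣m+n∣m⇒∣n (subst (_ ∣_) n≡kd+s d∣n) (n∣m*n k)

  -- Modulo `X`, `C * E` is `Y`, so `E * (Y + C * x)` becomes `Y * (E + x)`, and `Y` can be
  -- cancelled.
  cancel-coprime : ∀ {X Y C E x} → Coprime X Y → X ∣ Y + C * x →
                   C * E ≡ Y + X * x → X ∣ E + x
  cancel-coprime {X} {Y} {C} {E} {x} coprime X∣Y+Cx CE≡Y+Xx =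
    coprime-divisor coprime (∣-sum (x * x) (∣n⇒∣m*n E X∣Y+Cx) eq)
    where
    open ≡-Reasoning
    expand : ∀ C E Y x → E * (Y + C * x) ≡ E * Y + C * E * x
    expand = solve-∀
    collect : ∀ E X Y x → E * Y + (Y + X * x) * x ≡ x * x * X + Y * (E + x)
    collect = solve-∀
    eq : E * (Y + C * x) ≡ x * x * X + Y * (E + x)
    eq = begin
      E * (Y + C * x)            ≡⟨ expand C E Y x ⟩
      E * Y + C * E * x          ≡⟨ cong (λ z → E * Y + z * x) CE≡Y+Xx ⟩
      E * Y + (Y + X * x) * x    ≡⟨ collect E X Y x ⟩
      x * x * X + Y * (E + x)    ∎

  -- Here `E + q` is `suc E * suc H` modulo `A`. Also `B = E + p` is `suc E` modulo `A`, so `suc E`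
  -- is coprime to `A` and cancels.
  A∣1+H : ∀ {A B E H p} → Coprime A B → B ≡ E + p → p ≡ 1 + A * H →
          A ∣ E + suc (B * H) → A ∣ suc H
  A∣1+H {A} {E = E} {H} coprime refl refl A∣E+q =
    coprime-divisor {A} coprime′ (∣-sum (H * H) A∣E+q (eq A E H))
    where
    eq : ∀ A E H → E + (1 + (E + (1 + A * H)) * H) ≡ H * H * A + suc E * suc H
    eq = solve-∀
    coprime′ : Coprime A (suc E)
    coprime′ {d} (d∣A , d∣1+E) = coprime (d∣A ,
      subst (d ∣_) (sym (+-suc E (A * H))) (∣m∣n⇒∣m+n {d} {suc E} d∣1+E (∣m⇒∣m*n H d∣A)))

  -- Modulo `E` both `p` and `B` reduce to `D`.
  E∣A+D² : ∀ {A B C D E p} → B ≡ E + p → p ≡ E + D → C * E ≡ A + B * p → E ∣ A + D * D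
  E∣A+D² {A} {C = C} {D} {E} refl refl CE≡A+Bp =
    ∣-sum (2 * E + 3 * D) (n∣m*n C) (trans CE≡A+Bp (eq A D E))
    where
    eq : ∀ A D E → A + (E + (E + D)) * (E + D) ≡ (2 * E + 3 * D) * E + (A + D * D)
    eq = solve-∀

  -- The bound in integers, and criteria for it.

  -- Writing X = 2D + 1 and t = (2a + 1)/X, the inequalities say X² ≥ (4p − 3) − 4a and
  -- t < 1/√N; so (X + t)² > 4p − 3, and t separates √(4p − 3) − X from 1/√N.
  Bound : (N B p : ℕ) → Set
  Bound N B p = ∃[ D ] ∃[ a ]
    B + D ≡ 2 * p × p ≤ D * D + D + 1 + a × N * ((2 * a + 1) * (2 * a + 1)) < (2 * D + 1) * (2 * D + 1)

  -- For `a = 0` the second inequality is automatic: `N ≤ 7 < 9 ≤ (2D + 1)²`.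
  bound-a≡0 : ∀ {N B D p} → N ≤ 7 → 0 < D → B + D ≡ 2 * p → p ≤ D * D + D + 1 → Bound N B p
  bound-a≡0 {N} {D = D} N≤7 0<D B+D≡2p p≤ = D , 0 , B+D≡2p , ≤-trans p≤ (m≤m+n _ 0) ,
    (begin-strict
      N * 1                        ≡⟨ *-identityʳ N ⟩
      N                            ≤⟨ N≤7 ⟩
      7                            <⟨ s≤s (m≤n+m 7 1) ⟩
      3 * 3                        ≤⟨ *-mono-≤ 3≤X 3≤X ⟩
      (2 * D + 1) * (2 * D + 1)    ∎)
    where
    open ≤-Reasoning
    3≤X : 3 ≤ 2 * D + 1
    3≤X = +-monoˡ-≤ 1 (*-monoʳ-≤ 2 0<D)

  bound-B<p : ∀ {N B p} → N ≤ 7 → B < p → Bound N B p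
  bound-B<p {N} {B} {p} N≤7 B<p = bound-a≡0 N≤7 (≤-trans (≤-trans (s≤s z≤n) B<p) p≤D)
    (m+[n∸m]≡n (≤-trans (<⇒≤ B<p) (m≤m+n p (p + 0))))
    (begin
      p              ≤⟨ p≤D ⟩
      D              ≤⟨ m≤n+m D (D * D) ⟩
      D * D + D      ≤⟨ m≤m+n _ 1 ⟩
      D * D + D + 1  ∎)
    where
    open ≤-Reasoning
    D = 2 * p ∸ B
    p≤D : p ≤ D
    p≤D = begin
      p              ≡⟨ sym (m+n∸m≡n p p) ⟩
      p + p ∸ p      ≤⟨ ∸-monoʳ-≤ (p + p) (<⇒≤ B<p) ⟩
      p + p ∸ B      ≡⟨ cong (λ z → p + z ∸ B) (+-identityʳ p) ⟨
      2 * p ∸ B      ∎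

  n²≤m²+m⇒n≤m : ∀ {m n} → n * n ≤ m * m + m → n ≤ m
  n²≤m²+m⇒n≤m {m} {n} n²≤m²+m = ≮⇒≥ λ m<n → <-irrefl refl (begin-strict
      n * n          ≤⟨ n²≤m²+m ⟩
      m * m + m      ≡⟨ +-comm (m * m) m ⟩
      m + m * m      ≡⟨ *-suc m m ⟨
      m * suc m      ≤⟨ *-monoʳ-≤ m m<n ⟩
      m * n          <⟨ *-monoˡ-< n {{>-nonZero (≤-trans (s≤s z≤n) m<n)}} m<n ⟩
      n * n          ∎)
    where open ≤-Reasoning

  -- Now `A = H + 1` and `p = H² + H + 1`. The hypothesis becomes `H² ≤ D² + D`, which forces
  -- `H ≤ D`.
  m≡1⇒p≤D²+D+1 : ∀ {A D H p} → suc H ≡ 1 * A → p ≡ 1 + A * H → p ≤ A + D * D + D →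
                 p ≤ D * D + D + 1
  m≡1⇒p≤D²+D+1 {A} {D} {H} 1+H≡1*A refl p≤
    with refl ← trans 1+H≡1*A (*-identityˡ A) = begin
      1 + (H + H * H)    ≡⟨ eq H ⟩
      H * H + H + 1      ≤⟨ +-monoˡ-≤ 1 (+-mono-≤ (*-mono-≤ h h) h) ⟩
      D * D + D + 1      ∎
    where
    open ≤-Reasoning
    eq : ∀ H → 1 + (H + H * H) ≡ H * H + H + 1
    eq = solve-∀
    h : H ≤ D
    h = n²≤m²+m⇒n≤m (+-cancelˡ-≤ (suc H) (H * H) (D * D + D)
      (subst (suc H + H * H ≤_) (+-assoc (suc H) (D * D) D) p≤))

  -- Stated for an arbitrary pair because it serves `p` with `A`, `q` with `B` and `r` with `C`.
  x+X≡1+mAX : ∀ {m A X H x} → suc H ≡ m * A → x ≡ suc (X * H) → x + X ≡ 1 + m * (A * X)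
  x+X≡1+mAX {m} {A} {X} {H} 1+H≡mA refl =
    trans (eq X H) (trans (cong (λ z → 1 + X * z) 1+H≡mA) (eq′ m A X))
    where
    eq : ∀ X H → suc (X * H) + X ≡ 1 + X * suc H
    eq = solve-∀
    eq′ : ∀ m A X → 1 + X * (m * A) ≡ 1 + m * (A * X)
    eq′ = solve-∀

  -- With `A = a + 1`, the number `4(p + A) + 1 = 4mA² + 5` is at most `(2D + 1)² + 8A` and exceeds
  -- `m(2A - 1)² + 8A`.
  m≥3⇒N[2a+1]²<[2D+1]² : ∀ {N m a D H p} → N ≤ m → 3 ≤ m → suc H ≡ m * suc a → p ≡ 1 + suc a * H →
    p ≤ suc a + D * D + D → N * ((2 * a + 1) * (2 * a + 1)) < (2 * D + 1) * (2 * D + 1)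
  m≥3⇒N[2a+1]²<[2D+1]² {N} {m} {a} {D} {H} {p} N≤m 3≤m 1+H≡mA p≡1+AH p≤
    with k , refl ← m≤n⇒∃[o]m+o≡n 3≤m = +-cancelʳ-< (8 * suc a) _ _ (begin-strict
      N * ((2 * a + 1) * (2 * a + 1)) + 8 * suc a
        ≤⟨ +-monoˡ-≤ _ (*-monoˡ-≤ _ N≤m) ⟩
      m * ((2 * a + 1) * (2 * a + 1)) + 8 * suc a
        -- The added term is `(4m - 8)A - m + 5` rewritten in `k = m - 3` and `a = A - 1`, where no
        -- subtraction is left and the 6 shows positivity.
        <⟨ m<m+n (m * ((2 * a + 1) * (2 * a + 1)) + 8 * suc a)
             {6 + (4 * a + 4 * (k * a) + 3 * k)} (s≤s z≤n) ⟩
      m * ((2 * a + 1) * (2 * a + 1)) + 8 * suc a + (6 + (4 * a + 4 * (k * a) + 3 * k))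
        ≤⟨ ≤-reflexive (eq k a) ⟩
      4 * (1 + m * (suc a * suc a)) + 1
        ≡⟨ cong (λ z → 4 * z + 1) (x+X≡1+mAX {m} {suc a} {suc a} 1+H≡mA p≡1+AH) ⟨
      4 * (p + suc a) + 1
        ≤⟨ +-monoˡ-≤ 1 (*-monoʳ-≤ 4 (+-monoˡ-≤ (suc a) p≤)) ⟩
      4 * (suc a + D * D + D + suc a) + 1
        ≡⟨ eq′ a D ⟩
      (2 * D + 1) * (2 * D + 1) + 8 * suc a ∎)
    where
    open ≤-Reasoning
    eq : ∀ k a → (3 + k) * ((2 * a + 1) * (2 * a + 1)) + 8 * suc a + (6 + (4 * a + 4 * (k * a) + 3 * k))
                 ≡ 4 * (1 + (3 + k) * (suc a * suc a)) + 1
    eq = solve-∀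
    eq′ : ∀ a D → 4 * (suc a + D * D + D + suc a) + 1 ≡ (2 * D + 1) * (2 * D + 1) + 8 * suc a
    eq′ = solve-∀

  -- Were `p > D² + D + 1`, then `E ≥ D² + 2`, so `2E ≤ A + D²` would give `D² ≤ A`. Then
  -- `2p = 2E + 2D ≤ A + 3D² ≤ 4A`, against `p > 2A`.
  l≥2⇒p≤D²+D+1 : ∀ {A D E p} → 1 + 2 * A ≤ p → p ≡ E + D → 2 * E ≤ A + D * D → p ≤ D * D + D + 1
  l≥2⇒p≤D²+D+1 {A} {D} {E} 1+2A≤p refl 2E≤A+D² = ≮⇒≥ λ D²+D+1<p → <-irrefl refl (begin-strict
      4 * A                                ≤⟨ m≤n+m (4 * A) 1 ⟩
      1 + 4 * A                            <⟨ ≤-reflexive (eq₁ A) ⟩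
      2 * (1 + 2 * A)                      ≤⟨ *-monoʳ-≤ 2 1+2A≤p ⟩
      2 * (E + D)                          ≡⟨ *-distribˡ-+ 2 E D ⟩
      2 * E + 2 * D                        ≤⟨ +-mono-≤ 2E≤A+D² (*-monoʳ-≤ 2 (D≤D² D)) ⟩
      A + D * D + 2 * (D * D)              ≡⟨ eq₂ A D ⟩
      A + 3 * (D * D)                      ≤⟨ +-monoʳ-≤ A (*-monoʳ-≤ 3 (D²≤A D²+D+1<p)) ⟩
      A + 3 * A                            ∎)
    where
    open ≤-Reasoning
    eq₁ : ∀ A → 2 + 4 * A ≡ 2 * (1 + 2 * A)
    eq₁ = solve-∀
    eq₂ : ∀ A D → A + D * D + 2 * (D * D) ≡ A + 3 * (D * D)
    eq₂ = solve-∀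
    eq₃ : ∀ D → D + (D * D + 2) ≡ suc (D * D + D + 1)
    eq₃ = solve-∀
    eq₄ : ∀ D → D * D + D * D + 4 ≡ 2 * (D * D + 2)
    eq₄ = solve-∀
    D≤D² : ∀ D → D ≤ D * D
    D≤D² zero    = z≤n
    D≤D² (suc D) = m≤m+n (suc D) (D * suc D)
    D²≤A : D * D + D + 1 < E + D → D * D ≤ A
    D²≤A D²+D+1<p = +-cancelʳ-≤ (D * D) (D * D) A (begin
      D * D + D * D          ≤⟨ m≤m+n _ 4 ⟩
      D * D + D * D + 4      ≡⟨ eq₄ D ⟩
      2 * (D * D + 2)        ≤⟨ *-monoʳ-≤ 2 (+-cancelˡ-≤ D (D * D + 2) E (begin
        D + (D * D + 2)        ≡⟨ eq₃ D ⟩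
        suc (D * D + D + 1)    ≤⟨ D²+D+1<p ⟩
        E + D                  ≡⟨ +-comm E D ⟩
        D + E                  ∎)) ⟩
      2 * E                  ≤⟨ 2E≤A+D² ⟩
      A + D * D              ∎)

  -- Residues modulo 3 and 9: the exceptional values m = 5 and m = 3.

  %-cong : ∀ n .{{_ : NonZero n}} {i j} u v → i + u * n ≡ j + v * n → i % n ≡ j % n
  %-cong n {i} {j} u v eq =
    trans (sym ([m+kn]%n≡m%n i u n)) (trans (cong (_% n) eq) ([m+kn]%n≡m%n j v n))

  -- The equation is the one that `l = 1` produces. For numerals `m`, `i`, `j` both residues
  -- compute, so an impossible pair is refuted by `λ ()`.
  residues₃ : ∀ m i j a d → let A = i + a * 3; D = j + d * 3 in
    2 * A + (D * D + D) ≡ 1 + m * (A * A) → (2 * i + (j * j + j)) % 3 ≡ (1 + m * (i * i)) % 3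
  residues₃ m i j a d eq = %-cong 3 (2 * a + (2 * j * d + 3 * d * d + d)) (m * (2 * i * a + 3 * a * a))
    (trans (left i j a d) (trans eq (right m i a)))
    where
    left : ∀ i j a d → 2 * i + (j * j + j) + (2 * a + (2 * j * d + 3 * d * d + d)) * 3 ≡
      2 * (i + a * 3) + ((j + d * 3) * (j + d * 3) + (j + d * 3))
    left = solve-∀
    right : ∀ m i a → 1 + m * ((i + a * 3) * (i + a * 3)) ≡
      1 + m * (i * i) + m * (2 * i * a + 3 * a * a) * 3
    right = solve-∀

  -- Equivalently (10A − 2)² + 21 = 5(2D + 1)²: modulo 3 both squares vanish, but 9 ∤ 21.
  m≢5 : ∀ {A D} → 2 * A + (D * D + D) ≢ 1 + 5 * (A * A)
  m≢5 {A} {D} eq = cases (A % 3) (D % 3) (A / 3) (D / 3) (m%n<n A 3) (m%n<n D 3)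
      (subst₂ (λ A D → 2 * A + (D * D + D) ≡ 1 + 5 * (A * A)) (m≡m%n+[m/n]*n A 3) (m≡m%n+[m/n]*n D 3) eq)
    where
    left : ∀ a d → (d * d + d) * 9 + (6 + 6 * a) ≡
      2 * (2 + a * 3) + ((1 + d * 3) * (1 + d * 3) + (1 + d * 3))
    left = solve-∀
    right : ∀ a → 1 + 5 * ((2 + a * 3) * (2 + a * 3)) ≡
      6 + (5 * a * a + 6 * a + 1) * 9 + (6 + 6 * a)
    right = solve-∀
    mod9 : ∀ a d → let A = 2 + a * 3; D = 1 + d * 3 in 2 * A + (D * D + D) ≢ 1 + 5 * (A * A)
    mod9 a d eq = contradiction (%-cong 9 {0} {6} (d * d + d) (5 * a * a + 6 * a + 1)
      (+-cancelʳ-≡ (6 + 6 * a) ((d * d + d) * 9) (6 + (5 * a * a + 6 * a + 1) * 9)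
        (trans (left a d) (trans eq (right a))))) λ ()
    cases : ∀ i j a d → i < 3 → j < 3 → let A = i + a * 3; D = j + d * 3 in
      2 * A + (D * D + D) ≢ 1 + 5 * (A * A)
    cases 0 0 a d _ _ eq = contradiction (residues₃ 5 0 0 a d eq) λ ()
    cases 0 1 a d _ _ eq = contradiction (residues₃ 5 0 1 a d eq) λ ()
    cases 0 2 a d _ _ eq = contradiction (residues₃ 5 0 2 a d eq) λ ()
    cases 1 0 a d _ _ eq = contradiction (residues₃ 5 1 0 a d eq) λ ()
    cases 1 1 a d _ _ eq = contradiction (residues₃ 5 1 1 a d eq) λ ()
    cases 1 2 a d _ _ eq = contradiction (residues₃ 5 1 2 a d eq) λ ()
    cases 2 0 a d _ _ eq = contradiction (residues₃ 5 2 0 a d eq) λ ()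
    cases 2 1 a d _ _ eq = mod9 a d eq
    cases 2 2 a d _ _ eq = contradiction (residues₃ 5 2 2 a d eq) λ ()
    cases (suc (suc (suc _))) _ _ _ (s≤s (s≤s (s≤s ())))
    cases _ (suc (suc (suc _))) _ _ _ (s≤s (s≤s (s≤s ())))

  -- As `H + 1 = 3A`, each of `p + A`, `q + B`, `r + C` is 1 modulo 3. The quadratic equation
  -- excludes A ≡ 0. If A ≡ 1 then 3 divides `p`. If A ≡ 2 it leaves D ≡ 0, where 3 divides `q`, and
  -- D ≡ 2, where 3 divides `r`.
  3∣pqr : ∀ {A B C D H p q r} → suc H ≡ 3 * A →
    p ≡ suc (A * H) → q ≡ suc (B * H) → r ≡ suc (C * H) → B + D ≡ 2 * p → C ≡ 2 * p + D + 1 →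
    2 * A + (D * D + D) ≡ 1 + 3 * (A * A) → 3 ∣ p ⊎ 3 ∣ q ⊎ 3 ∣ r
  3∣pqr {A} {B} {C} {D} {H} {p} {q} {r} 1+H≡3A p≡ q≡ r≡ B+D≡2p C≡ eq =
    cases (A % 3) (D % 3) (A / 3) (D / 3) (m%n<n A 3) (m%n<n D 3)
      (m≡m%n+[m/n]*n A 3) (m≡m%n+[m/n]*n D 3)
    where
    open ≡-Reasoning
    p+A≡ : p + A ≡ 1 + 3 * (A * A)
    p+A≡ = x+X≡1+mAX {3} {A} {A} 1+H≡3A p≡

    -- Both `B + D` and `C` bring in `2 * p`; adding `2 * A` eliminates it modulo 3.
    2p+2A≡ : 2 * p + 2 * A ≡ 2 + 3 * (2 * (A * A))
    2p+2A≡ = trans (sym (*-distribˡ-+ 2 p A)) (trans (cong (2 *_) p+A≡) (eq′ (A * A)))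
      where
      eq′ : ∀ x → 2 * (1 + 3 * x) ≡ 2 + 3 * (2 * x)
      eq′ = solve-∀

    3∣p : ∀ {a} → A ≡ 1 + a * 3 → 3 ∣ p
    3∣p {a} A≡ = ∣-sum {3} {3 * (A * A)} a (m∣m*n (A * A)) (suc-injective (begin
      1 + 3 * (A * A)      ≡⟨ p+A≡ ⟨
      p + A                ≡⟨ cong (p +_) A≡ ⟩
      p + (1 + a * 3)      ≡⟨ +-comm p (1 + a * 3) ⟩
      1 + a * 3 + p        ∎))

    3∣q : ∀ {a d} → A ≡ 2 + a * 3 → D ≡ d * 3 → 3 ∣ q
    3∣q {a} {d} A≡ D≡ = ∣-sum {3} {(A * B + d + 2 * a + 1) * 3} (2 * (A * A))
      (n∣m*n (A * B + d + 2 * a + 1)) (+-cancelˡ-≡ 2 _ _ (begin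
      2 + (A * B + d + 2 * a + 1) * 3         ≡⟨ eq₁ (A * B) d a ⟩
      1 + 3 * (A * B) + d * 3 + 2 * (2 + a * 3)
        ≡⟨ cong₂ (λ D A′ → 1 + 3 * (A * B) + D + 2 * A′) D≡ A≡ ⟨
      1 + 3 * (A * B) + D + 2 * A             ≡⟨ cong (λ z → z + D + 2 * A) (x+X≡1+mAX {3} {A} {B} 1+H≡3A q≡) ⟨
      q + B + D + 2 * A                       ≡⟨ cong (_+ 2 * A) (+-assoc q B D) ⟩
      q + (B + D) + 2 * A                     ≡⟨ cong (λ z → q + z + 2 * A) B+D≡2p ⟩
      q + 2 * p + 2 * A                       ≡⟨ +-assoc q (2 * p) (2 * A) ⟩
      q + (2 * p + 2 * A)                     ≡⟨ cong (q +_) 2p+2A≡ ⟩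
      q + (2 + 3 * (2 * (A * A)))             ≡⟨ eq₂ q (A * A) ⟩
      2 + (2 * (A * A) * 3 + q)               ∎))
      where
      eq₁ : ∀ x d a → 2 + (x + d + 2 * a + 1) * 3 ≡ 1 + 3 * x + d * 3 + 2 * (2 + a * 3)
      eq₁ = solve-∀
      eq₂ : ∀ q x → q + (2 + 3 * (2 * x)) ≡ 2 + (2 * x * 3 + q)
      eq₂ = solve-∀

    3∣r : ∀ {a d} → A ≡ 2 + a * 3 → D ≡ 2 + d * 3 → 3 ∣ r
    3∣r {a} {d} A≡ D≡ = ∣-sum {3} {(A * C + 2 * a) * 3} (2 * (A * A) + d)
      (n∣m*n (A * C + 2 * a)) (+-cancelˡ-≡ 5 _ _ (begin
      5 + (A * C + 2 * a) * 3                 ≡⟨ eq₁ (A * C) a ⟩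
      1 + 3 * (A * C) + 2 * (2 + a * 3)       ≡⟨ cong (λ A′ → 1 + 3 * (A * C) + 2 * A′) A≡ ⟨
      1 + 3 * (A * C) + 2 * A                 ≡⟨ cong (_+ 2 * A) (x+X≡1+mAX {3} {A} {C} 1+H≡3A r≡) ⟨
      r + C + 2 * A                           ≡⟨ cong (λ z → r + z + 2 * A) C≡ ⟩
      r + (2 * p + D + 1) + 2 * A             ≡⟨ eq₂ r p D A ⟩
      r + (2 * p + 2 * A) + D + 1             ≡⟨ cong₂ (λ y D → r + y + D + 1) 2p+2A≡ D≡ ⟩
      r + (2 + 3 * (2 * (A * A))) + (2 + d * 3) + 1    ≡⟨ eq₃ r (A * A) d ⟩
      5 + ((2 * (A * A) + d) * 3 + r)         ∎))
      where
      eq₁ : ∀ x a → 5 + (x + 2 * a) * 3 ≡ 1 + 3 * x + 2 * (2 + a * 3)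
      eq₁ = solve-∀
      eq₂ : ∀ r p D A → r + (2 * p + D + 1) + 2 * A ≡ r + (2 * p + 2 * A) + D + 1
      eq₂ = solve-∀
      eq₃ : ∀ r x d → r + (2 + 3 * (2 * x)) + (2 + d * 3) + 1 ≡ 5 + ((2 * x + d) * 3 + r)
      eq₃ = solve-∀

    residues : ∀ {i j a d} → A ≡ i + a * 3 → D ≡ j + d * 3 →
      (2 * i + (j * j + j)) % 3 ≡ (1 + 3 * (i * i)) % 3
    residues {i} {j} {a} {d} A≡ D≡ = residues₃ 3 i j a d
      (subst₂ (λ A D → 2 * A + (D * D + D) ≡ 1 + 3 * (A * A)) A≡ D≡ eq)

    cases : ∀ i j a d → i < 3 → j < 3 → A ≡ i + a * 3 → D ≡ j + d * 3 → 3 ∣ p ⊎ 3 ∣ q ⊎ 3 ∣ r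
    cases 0 0 a d _ _ A≡ D≡ = contradiction (residues {0} {0} {a} {d} A≡ D≡) λ ()
    cases 0 1 a d _ _ A≡ D≡ = contradiction (residues {0} {1} {a} {d} A≡ D≡) λ ()
    cases 0 2 a d _ _ A≡ D≡ = contradiction (residues {0} {2} {a} {d} A≡ D≡) λ ()
    cases 1 _ a d _ _ A≡ D≡ = inj₁ (3∣p {a} A≡)
    cases 2 0 a d _ _ A≡ D≡ = inj₂ (inj₁ (3∣q {a} {d} A≡ D≡))
    cases 2 1 a d _ _ A≡ D≡ = contradiction (residues {2} {1} {a} {d} A≡ D≡) λ ()
    cases 2 2 a d _ _ A≡ D≡ = inj₂ (inj₂ (3∣r {a} {d} A≡ D≡))
    cases (suc (suc (suc _))) _ _ _ (s≤s (s≤s (s≤s ())))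
    cases _ (suc (suc (suc _))) _ _ _ (s≤s (s≤s (s≤s ())))

  -- Passage to the quotients A, B, C and to the case B = E + p.

  -- With H = gcd(p − 1, q − 1, r − 1) the three divisibilities become divisibilities
  -- between A, B, C; as in the paper E = (pq − 1)/(r − 1) = (A + Bp)/C.
  record Reduced (p q r B : ℕ) : Set where
    field
      A C E H   : ℕ
      p≡1+AH    : p ≡ suc (A * H)
      q≡1+BH    : q ≡ suc (B * H)
      r≡1+CH    : r ≡ suc (C * H)
      0<A       : 0 < A
      0<H       : 0 < H
      2∣H       : 2 ∣ H
      coprime   : Coprime A B
      A∣B+Cq    : A ∣ B + C * q
      B∣A+Cp    : B ∣ A + C * p
      CE≡A+Bp   : C * E ≡ A + B * p
      E<p       : E < p

  -- The case E + p = B of the relation B ∣ E + p; otherwise 2B ≤ E + p < 2p.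
  record Extremal (p q r B : ℕ) : Set where
    field
      A C D E H m l : ℕ
      p≡1+AH    : p ≡ suc (A * H)
      q≡1+BH    : q ≡ suc (B * H)
      r≡1+CH    : r ≡ suc (C * H)
      0<A       : 0 < A
      0<H       : 0 < H
      2∣H       : 2 ∣ H
      B≡E+p     : B ≡ E + p
      p≡E+D     : p ≡ E + D
      0<D       : 0 < D
      CE≡A+Bp   : C * E ≡ A + B * p
      1+H≡mA    : suc H ≡ m * A
      A+D²≡lE   : A + D * D ≡ l * E

  -- Modulo `d` the factor `suc d` is 1.
  ∣-pred : ∀ {d n} m → 0 < m → n ≡ m * suc d → d ∣ n ∸ 1 → d ∣ m ∸ 1
  ∣-pred {d} (suc m) _ refl d∣n-1 = ∣-sum {d} (suc m) d∣n-1 (eq m d)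
    where
    eq : ∀ m d → d + m * suc d ≡ suc m * d + m
    eq = solve-∀

  -- The divisor `X * H` of `n ∸ 1` also divides `yz - 1` for the other two factors `y = 1 + YH`,
  -- `z = 1 + ZH`, and `yz - 1 = (Y + Zy)H`.
  ∣-cofactor : ∀ {X H n} .{{_ : NonZero H}} Y Z → n ≡ suc (Y * H) * suc (Z * H) * suc (X * H) →
               X * H ∣ n ∸ 1 → X ∣ Y + Z * suc (Y * H)
  ∣-cofactor {X} {H} Y Z n≡ XH∣n-1 = *-cancelʳ-∣ H
    (subst (X * H ∣_) (eq Y Z H)
      (∣-pred (suc (Y * H) * suc (Z * H)) (s≤s z≤n) n≡ XH∣n-1))
    where
    eq : ∀ Y Z H → Z * H + Y * H * suc (Z * H) ≡ (Y + Z * suc (Y * H)) * H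
    eq = solve-∀

  2∣n⊎2∣1+n : ∀ n → 2 ∣ n ⊎ 2 ∣ suc n
  2∣n⊎2∣1+n zero = inj₁ (2 ∣0)
  2∣n⊎2∣1+n (suc n) with 2∣n⊎2∣1+n n
  ... | inj₁ 2∣n   = inj₂ (∣m∣n⇒∣m+n {2} {2} ∣-refl 2∣n)
  ... | inj₂ 2∣1+n = inj₁ 2∣1+n

  odd⇒2∣pred : ∀ {n} → 2 ∤ n → 2 ∣ n ∸ 1
  odd⇒2∣pred {zero}  2∤n = contradiction (2 ∣0) 2∤n
  odd⇒2∣pred {suc n} 2∤n with 2∣n⊎2∣1+n n
  ... | inj₁ 2∣n   = 2∣n
  ... | inj₂ 2∣1+n = contradiction 2∣1+n 2∤n

  -- A common divisor `d` of `A` and `B` also divides `C`, since `suc (A * H)` is 1 modulo `d`.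
  -- Hence `d * H` divides all three multiples of `H`, and so divides `H`.
  quotients-coprime : ∀ {A B C H} .{{_ : NonZero H}} →
    (∀ {d} → d ∣ A * H → d ∣ B * H → d ∣ C * H → d ∣ H) →
    B ∣ A + C * suc (A * H) → Coprime A B
  quotients-coprime {A} {B} {C} {H} greatest B∣A+Cp {d} (d∣A , d∣B) =
    ∣1⇒≡1 (*-cancelʳ-∣ H (subst (d * H ∣_) (sym (*-identityˡ H))
      (greatest (*-monoˡ-∣ H d∣A) (*-monoˡ-∣ H d∣B) (*-monoˡ-∣ H d∣C))))
    where
    eq : ∀ C A H → C * suc (A * H) ≡ C * H * A + C
    eq = solve-∀
    d∣C : d ∣ C
    d∣C = ∣m+n∣m⇒∣n {d} {C * H * A} (subst (d ∣_) (eq C A H) (∣m+n∣m⇒∣n (∣-trans d∣B B∣A+Cp) d∣A))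
      (∣n⇒∣m*n (C * H) d∣A)

  reduce : ∀ {n p q r A B C H} → n ≡ p * q * r → 1 < p → q < r →
    p ≡ suc (A * H) → q ≡ suc (B * H) → r ≡ suc (C * H) → 2 ∣ H →
    (∀ {d} → d ∣ A * H → d ∣ B * H → d ∣ C * H → d ∣ H) →
    A * H ∣ n ∸ 1 → B * H ∣ n ∸ 1 → C * H ∣ n ∸ 1 → Reduced p q r B
  reduce {n} {A = A} {B} {C} {H} n≡pqr (s≤s 0<AH) (s≤s BH<CH) refl refl refl 2∣H greatest
         AH∣n-1 BH∣n-1 CH∣n-1 = record
    { A       = A
    ; C       = C
    ; E       = quotient C∣A+Bp
    ; H       = H
    ; p≡1+AH  = refl
    ; q≡1+BH  = refl
    ; r≡1+CH  = refl
    ; 0<A     = n≢0⇒n>0 λ A≡0 → <⇒≢ 0<AH (sym (cong (_* H) A≡0))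
    ; 0<H     = 0<H
    ; 2∣H     = 2∣H
    ; coprime = quotients-coprime {A} {B} {C} greatest B∣A+Cp
    ; A∣B+Cq  = ∣-cofactor B C (trans n≡pqr (rotate p q r)) AH∣n-1
    ; B∣A+Cp  = B∣A+Cp
    ; CE≡A+Bp = trans (*-comm C (quotient C∣A+Bp)) (sym (_∣_.equality C∣A+Bp))
    -- Since `A < p` and `B < C`, `p ≤ E` would give `A + Bp < (B + 1)p ≤ CE`.
    ; E<p     = ≰⇒> λ p≤E → <-irrefl refl (begin-strict
        A + B * p                <⟨ +-monoˡ-< (B * p) (s≤s (m≤m*n A H)) ⟩
        p + B * p                ≤⟨ *-mono-≤ (*-cancelʳ-< H B C BH<CH) p≤E ⟩
        C * quotient C∣A+Bp      ≡⟨ *-comm C (quotient C∣A+Bp) ⟩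
        quotient C∣A+Bp * C      ≡⟨ _∣_.equality C∣A+Bp ⟨
        A + B * p                ∎)
    }
    where
    open ≤-Reasoning
    p q r : ℕ
    p = suc (A * H)
    q = suc (B * H)
    r = suc (C * H)
    0<H : 0 < H
    0<H = n≢0⇒n>0 λ H≡0 → <⇒≢ 0<AH (sym (trans (cong (A *_) H≡0) (*-zeroʳ A)))
    instance
      H≢0 : NonZero H
      H≢0 = >-nonZero 0<H
    rotate : ∀ x y z → x * y * z ≡ y * z * x
    rotate = solve-∀
    swap : ∀ x y z → x * y * z ≡ x * z * y
    swap = solve-∀
    B∣A+Cp : B ∣ A + C * p
    B∣A+Cp = ∣-cofactor A C (trans n≡pqr (swap p q r)) BH∣n-1
    C∣A+Bp : C ∣ A + B * p
    C∣A+Bp = ∣-cofactor A B n≡pqr CH∣n-1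

  reduced : ∀ {n p q r} → K₃N n p q r → Reduced p q r (Defs.B p q r)
  reduced {n} {p} {q} {r} k = from-quotients (∣-trans H∣g (gcd[m,n]∣m (p ∸ 1) (q ∸ 1)))
      (Defs.H∣q-1 p q r) (gcd[m,n]∣n (gcd (p ∸ 1) (q ∸ 1)) (r ∸ 1))
    where
    open K₃N k hiding (E)
    H∣g : Defs.H p q r ∣ gcd (p ∸ 1) (q ∸ 1)
    H∣g = gcd[m,n]∣m (gcd (p ∸ 1) (q ∸ 1)) (r ∸ 1)
    1<q : 1 < q
    1<q = <-trans 1<p p<q
    ≡suc : ∀ {x y} → 1 < x → x ∸ 1 ≡ y → x ≡ suc y
    ≡suc {suc x} _ refl = refl
    from-quotients : Defs.H p q r ∣ p ∸ 1 → (d : Defs.H p q r ∣ q ∸ 1) → Defs.H p q r ∣ r ∸ 1 →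
      Reduced p q r (quotient d)
    from-quotients (divides A p-1≡AH) (divides B q-1≡BH) (divides C r-1≡CH) =
      reduce {A = A} {B} {C} n≡pqr 1<p q<r
        (≡suc 1<p p-1≡AH) (≡suc 1<q q-1≡BH) (≡suc (<-trans 1<q q<r) r-1≡CH)
        (gcd-greatest (gcd-greatest (odd⇒2∣pred p-odd) (odd⇒2∣pred q-odd)) (odd⇒2∣pred r-odd))
        (λ {d} d∣AH d∣BH d∣CH → gcd-greatest
          (gcd-greatest (subst (d ∣_) (sym p-1≡AH) d∣AH) (subst (d ∣_) (sym q-1≡BH) d∣BH))
          (subst (d ∣_) (sym r-1≡CH) d∣CH))
        (subst (_∣ n ∸ 1) p-1≡AH p-1∣n-1) (subst (_∣ n ∸ 1) q-1≡BH q-1∣n-1)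
        (subst (_∣ n ∸ 1) r-1≡CH r-1∣n-1)

  module _ {p q r B : ℕ} (R : Reduced p q r B) where
    open Reduced R

    B∣E+p : B ∣ E + p
    B∣E+p = cancel-coprime {B} {A} {C} (Coprimality.sym coprime) B∣A+Cp CE≡A+Bp

    -- `A + B * p = A + B + ABH` is symmetric in `A` and `B`, hence equals `B + A * q`, and the
    -- cancellation works with the roles exchanged.
    A∣E+q : A ∣ E + q
    A∣E+q = cancel-coprime {A} {B} {C} coprime A∣B+Cq (trans CE≡A+Bp
      (subst₂ (λ p q → A + B * p ≡ B + A * q) (sym p≡1+AH) (sym q≡1+BH) (eq A B H)))
      where
      eq : ∀ A B H → A + B * suc (A * H) ≡ B + A * suc (B * H)
      eq = solve-∀

    B<p⊎Extremal : B < p ⊎ Extremal p q r B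
    B<p⊎Extremal with B∣E+p
    ... | divides 0 E+p≡0 = contradiction (subst (p ≤_) E+p≡0 (m≤n+m p E)) (<⇒≱ (≤-<-trans z≤n E<p))
    ... | divides (suc (suc k)) E+p≡kB = inj₁ (*-cancelˡ-< 2 B p (begin-strict
      2 * B              ≤⟨ *-monoˡ-≤ B {2} {2 + k} (s≤s (s≤s z≤n)) ⟩
      (2 + k) * B        ≡⟨ E+p≡kB ⟨
      E + p              <⟨ +-monoˡ-< p E<p ⟩
      p + p              ≡⟨ cong (p +_) (+-identityʳ p) ⟨
      2 * p              ∎))
      where open ≤-Reasoning
    ... | divides 1 E+p≡1*B = inj₂ (extremal (A∣1+H {A} {B} {E} coprime B≡E+p p≡1+AH (subst (λ q → A ∣ E + q) q≡1+BH A∣E+q))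
        (E∣A+D² {C = C} B≡E+p p≡E+D CE≡A+Bp))
      where
      B≡E+p : B ≡ E + p
      B≡E+p = sym (trans E+p≡1*B (*-identityˡ B))
      p≡E+D : p ≡ E + (p ∸ E)
      p≡E+D = sym (m+[n∸m]≡n (<⇒≤ E<p))
      extremal : A ∣ suc H → E ∣ A + (p ∸ E) * (p ∸ E) → Extremal p q r B
      extremal (divides m 1+H≡mA) (divides l A+D²≡lE) = record
        { A       = A
        ; C       = C
        ; D       = p ∸ E
        ; E       = E
        ; H       = H
        ; m       = m
        ; l       = l
        ; p≡1+AH  = p≡1+AH
        ; q≡1+BH  = q≡1+BH
        ; r≡1+CH  = r≡1+CH
        ; 0<A     = 0<A
        ; 0<H     = 0<H
        ; 2∣H     = 2∣H
        ; B≡E+p   = B≡E+p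
        ; p≡E+D   = p≡E+D
        ; 0<D     = m<n⇒0<n∸m E<p
        ; CE≡A+Bp = CE≡A+Bp
        ; 1+H≡mA  = 1+H≡mA
        ; A+D²≡lE = A+D²≡lE
        }

  -- Case analysis on m and l.

  3∤prime : ∀ {n} → Prime n → 3 < n → 3 ∤ n
  3∤prime n-prime 3<n 3∣n with prime⇒irreducible n-prime 3∣n
  ... | inj₂ 3≡n = <⇒≢ 3<n 3≡n

  module _ {p q r B : ℕ} (X : Extremal p q r B) where
    open Extremal X

    B+D≡2p : B + D ≡ 2 * p
    B+D≡2p = begin
      B + D            ≡⟨ cong (_+ D) B≡E+p ⟩
      E + p + D        ≡⟨ eq E p D ⟩
      p + (E + D)      ≡⟨ cong (p +_) p≡E+D ⟨
      p + p            ≡⟨ cong (p +_) (+-identityʳ p) ⟨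
      2 * p            ∎
      where
      open ≡-Reasoning
      eq : ∀ E p D → E + p + D ≡ p + (E + D)
      eq = solve-∀

    l≢0 : l ≢ 0
    l≢0 l≡0 = <⇒≢ (≤-trans 0<A (m≤m+n A (D * D))) (sym (trans A+D²≡lE (cong (_* E) l≡0)))

    p≤A+D²+D : p ≤ A + D * D + D
    p≤A+D²+D = begin
      p                ≡⟨ p≡E+D ⟩
      E + D            ≤⟨ +-monoˡ-≤ D (m≤n*m E l {{≢-nonZero l≢0}}) ⟩
      l * E + D        ≡⟨ cong (_+ D) A+D²≡lE ⟨
      A + D * D + D    ∎
      where open ≤-Reasoning

    -- `m * A = H + 1` is odd because `H` is even.
    2∤m : 2 ∤ m
    2∤m 2∣m = from-no (2 ∣? 1) (∣m+n∣m⇒∣n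
      (subst (2 ∣_) (trans (sym 1+H≡mA) (+-comm 1 H)) (∣m⇒∣m*n A 2∣m)) 2∣H)

    small : ∀ {N} → N ≤ 7 → p ≤ D * D + D + 1 → Bound N B p
    small N≤7 = bound-a≡0 N≤7 0<D B+D≡2p

    m≡1⇒bound : ∀ {N} → N ≤ 7 → m ≡ 1 → Bound N B p
    m≡1⇒bound N≤7 m≡1 =
      small N≤7 (m≡1⇒p≤D²+D+1 {A} {D} {H} (trans 1+H≡mA (cong (_* A) m≡1)) p≡1+AH p≤A+D²+D)

    m≥3⇒bound : ∀ {N} → N ≤ m → 3 ≤ m → Bound N B p
    -- The witness `a` is `A - 1`, because `A + D² + D = D² + D + 1 + (A - 1)`.
    m≥3⇒bound {N} N≤m 3≤m = D , pred A , B+D≡2p , p≤ ,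
      m≥3⇒N[2a+1]²<[2D+1]² {N} {m} {pred A} {D} N≤m 3≤m (trans 1+H≡mA (cong (m *_) A≡))
        (trans p≡1+AH (cong (λ A → suc (A * H)) A≡))
        (subst (λ A → p ≤ A + D * D + D) A≡ p≤A+D²+D)
      where
      A≡ : A ≡ suc (pred A)
      A≡ = sym (suc-pred A {{>-nonZero 0<A}})
      eq : ∀ a D → suc a + D * D + D ≡ D * D + D + 1 + a
      eq = solve-∀
      p≤ : p ≤ D * D + D + 1 + pred A
      p≤ = subst (p ≤_) (trans (cong (λ A → A + D * D + D) A≡) (eq (pred A) D)) p≤A+D²+D

    2≤H : 2 ≤ H
    2≤H = ∣⇒≤ {{>-nonZero 0<H}} 2∣H

    l≥2⇒bound : ∀ {N} → N ≤ 7 → 2 ≤ l → Bound N B p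
    l≥2⇒bound N≤7 2≤l = small N≤7 (l≥2⇒p≤D²+D+1 {A} {D} {E} 1+2A≤p p≡E+D
      (≤-trans (*-monoˡ-≤ E 2≤l) (≤-reflexive (sym A+D²≡lE))))
      where
      1+2A≤p : 1 + 2 * A ≤ p
      1+2A≤p = subst (1 + 2 * A ≤_) (sym p≡1+AH)
        (s≤s (≤-trans (*-monoˡ-≤ A 2≤H) (≤-reflexive (*-comm H A))))

    module _ (l≡1 : l ≡ 1) where
      E≡A+D² : E ≡ A + D * D
      E≡A+D² = sym (trans A+D²≡lE (trans (cong (_* E) l≡1) (*-identityˡ E)))

      2A+D²+D≡1+mA² : 2 * A + (D * D + D) ≡ 1 + m * (A * A)
      2A+D²+D≡1+mA² = begin
        2 * A + (D * D + D)    ≡⟨ eq A D ⟩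
        A + D * D + D + A      ≡⟨ cong (λ E → E + D + A) E≡A+D² ⟨
        E + D + A              ≡⟨ cong (_+ A) p≡E+D ⟨
        p + A                  ≡⟨ x+X≡1+mAX {m} {A} {A} 1+H≡mA p≡1+AH ⟩
        1 + m * (A * A)        ∎
        where
        open ≡-Reasoning
        eq : ∀ A D → 2 * A + (D * D + D) ≡ A + D * D + D + A
        eq = solve-∀

      -- Substituting `E = A + D²`, `A + Bp = A + (2E + D)(E + D)` becomes `(2E + 3D + 1)E`; then
      -- `E` cancels.
      C≡2p+D+1 : C ≡ 2 * p + D + 1
      C≡2p+D+1 = *-cancelʳ-≡ C (2 * p + D + 1) E {{E≢0}} (begin
        C * E                                ≡⟨ CE≡A+Bp ⟩
        A + B * p                            ≡⟨ cong₂ (λ B p → A + B * p) B≡E+p p≡E+D ⟩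
        A + (E + p) * (E + D)                ≡⟨ cong (λ p → A + (E + p) * (E + D)) p≡E+D ⟩
        A + (E + (E + D)) * (E + D)          ≡⟨ eq A D E ⟩
        A + D * D + (2 * E + 3 * D) * E      ≡⟨ cong (_+ (2 * E + 3 * D) * E) E≡A+D² ⟨
        E + (2 * E + 3 * D) * E              ≡⟨ eq′ D E ⟩
        (2 * (E + D) + D + 1) * E            ≡⟨ cong (λ p → (2 * p + D + 1) * E) p≡E+D ⟨
        (2 * p + D + 1) * E                  ∎)
        where
        open ≡-Reasoning
        eq : ∀ A D E → A + (E + (E + D)) * (E + D) ≡ A + D * D + (2 * E + 3 * D) * E
        eq = solve-∀
        eq′ : ∀ D E → E + (2 * E + 3 * D) * E ≡ (2 * (E + D) + D + 1) * E
        eq′ = solve-∀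
        E≢0 : NonZero E
        E≢0 = >-nonZero (subst (0 <_) (sym E≡A+D²) (≤-trans 0<A (m≤m+n A (D * D))))

      -- If `A ≥ 2`, then `H ≥ 2` makes all three primes exceed 3, yet 3 divides one of them.
      m≡3⇒A≡1 : m ≡ 3 → p < q → q < r → Prime p → Prime q → Prime r → A ≡ 1
      m≡3⇒A≡1 m≡3 p<q q<r p-prime q-prime r-prime = ≤-antisym (≮⇒≥ ¬1<A) 0<A
        where
        3<p : 1 < A → 3 < p
        3<p 1<A = subst (3 <_) (sym p≡1+AH) (m≤n⇒m≤1+n (*-mono-≤ 1<A 2≤H))
        ¬1<A : ¬ 1 < A
        ¬1<A 1<A with 3∣pqr {A} {B} {C} {D} (trans 1+H≡mA (cong (_* A) m≡3)) p≡1+AH q≡1+BH r≡1+CH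
          B+D≡2p C≡2p+D+1 (trans 2A+D²+D≡1+mA² (cong (λ m → 1 + m * (A * A)) m≡3))
        ... | inj₁ 3∣p        = 3∤prime p-prime (3<p 1<A) 3∣p
        ... | inj₂ (inj₁ 3∣q) = 3∤prime q-prime (<-trans (3<p 1<A) p<q) 3∣q
        ... | inj₂ (inj₂ 3∣r) = 3∤prime r-prime (<-trans (<-trans (3<p 1<A) p<q) q<r) 3∣r

    bound₃ : Bound 3 B p
    bound₃ = cases m refl
      where
      3≤7 : 3 ≤ 7
      3≤7 = m≤m+n 3 4
      cases : ∀ k → m ≡ k → Bound 3 B p
      cases 0 m≡0 = contradiction (trans 1+H≡mA (cong (_* A) m≡0)) λ ()
      cases 1 m≡1 = m≡1⇒bound 3≤7 m≡1
      cases 2 m≡2 = contradiction (subst (2 ∣_) (sym m≡2) ∣-refl) 2∤m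
      cases (suc (suc (suc k))) m≡3+k = m≥3⇒bound 3≤m 3≤m
        where
        3≤m : 3 ≤ m
        3≤m = subst (3 ≤_) (sym m≡3+k) (m≤m+n 3 k)

    bound₇ : p < q → q < r → Prime p → Prime q → Prime r → Bound 7 B p
    bound₇ p<q q<r p-prime q-prime r-prime = cases m l refl refl
      where
      even : ∀ k {A : Set} → m ≡ k * 2 → A
      even k m≡2k = contradiction (divides k m≡2k) 2∤m
      cases : ∀ k j → m ≡ k → l ≡ j → Bound 7 B p
      cases _ 0 _ l≡0 = contradiction l≡0 l≢0
      cases _ (suc (suc j)) _ l≡2+j =
        l≥2⇒bound ≤-refl (subst (2 ≤_) (sym l≡2+j) (m≤m+n 2 j))
      cases 0 1 m≡0 _ = even 0 m≡0
      cases 1 1 m≡1 _ = m≡1⇒bound ≤-refl m≡1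
      cases 2 1 m≡2 _ = even 1 m≡2
      -- With `A = 1`, `p ≤ A + D² + D` is already the condition for `a = 0`.
      cases 3 1 m≡3 l≡1 = small ≤-refl (subst (p ≤_) (trans
        (cong (λ A → A + D * D + D) (m≡3⇒A≡1 l≡1 m≡3 p<q q<r p-prime q-prime r-prime))
        (+-comm 1 (D * D + D))) p≤A+D²+D)
      cases 4 1 m≡4 _ = even 2 m≡4
      cases 5 1 m≡5 l≡1 = contradiction
        (trans (2A+D²+D≡1+mA² l≡1) (cong (λ m → 1 + m * (A * A)) m≡5)) (m≢5 {A} {D})
      cases 6 1 m≡6 _ = even 3 m≡6
      cases (suc (suc (suc (suc (suc (suc (suc k))))))) 1 m≡7+k _ =
        m≥3⇒bound 7≤m (≤-trans (m≤m+n 3 4) 7≤m)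
        where
        7≤m : 7 ≤ m
        7≤m = subst (7 ≤_) (sym m≡7+k) (m≤m+n 7 k)

  K₃N⇒bound : ∀ {n p q r} → K₃N n p q r → Bound 3 (Defs.B p q r) p
  K₃N⇒bound k = [ bound-B<p (m≤m+n 3 4) , bound₃ ]′ (B<p⊎Extremal (reduced k))

  C₃N⇒bound : ∀ {n p q r} → C₃N n p q r → Bound 7 (Defs.B p q r) p
  C₃N⇒bound c = [ bound-B<p ≤-refl , (λ extremal → bound₇ extremal p<q q<r p-prime q-prime r-prime) ]′
    (B<p⊎Extremal (reduced k₃n))
    where
    open C₃N c
    open K₃N k₃n using (p<q; q<r)

open Arithmetic using (Bound; K₃N⇒bound; C₃N⇒bound)
open import Defs
open import Data.Integer using (+_; -[1+_])
open RationalLemmas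
open CornerLemmas
open PositiveLemmas

-- Cuts of sums, differences and products.

lower-+ : ∀ x y {a b} → lower x a → lower y b → lower (x + y) (a ℚ.+ b)
lower-+ x y {b = b} a<x b<y with lower-rounded x a<x
... | a′ , a<a′ , a′<x = a′ , b , a′<x , b<y , ℚ.+-monoˡ-< b a<a′

-- The first hypothesis expresses s ≤ x, so `s` itself need not lie in the lower cut; the strict
-- slack comes from rounding `q` down to `q′`.
lower-- : ∀ x y {s q} → (∀ {c} → c ℚ.< s → lower x c) → upper y q →
          lower (x - y) (s ℚ.- q)
lower-- x y {s} {q} below-s<x y<q with upper-rounded y y<q
... | q′ , q′<q , y<q′
  with ℚ.<-dense (ℚ.+-monoʳ-< s (ℚ.neg-antimono-< q′<q))
...   | m , s-q<m , m<s-q′ =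
  m ℚ.+ q′ , ℚ.- q′ ,
  below-s<x (subst (m ℚ.+ q′ ℚ.<_)
    (solve 2 (λ s q′ → s :+ :- q′ :+ q′ := s) refl s q′) (ℚ.+-monoˡ-< q′ m<s-q′)) ,
  subst (upper y) (sym (neg-involutive q′)) y<q′ ,
  subst (s ℚ.- q ℚ.<_) (solve 2 (λ m q′ → m := m :+ q′ :+ :- q′) refl m q′) s-q<m
  where open +-*-Solver

upper-fromℚ-- : ∀ {s t q} → s ℚ.- t ℚ.< q → upper (fromℚ s - fromℚ t) q
upper-fromℚ-- {s} {t} {q} s-t<q with ℚ.<-dense s-t<q
... | m , s-t<m , m<q with ℚ.<-dense (ℚ.+-monoˡ-< (ℚ.- m ℚ.+ ℚ.- t) m<q)
...   | b , m-m-t<b , b<q-m-t =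
  -- `m + t` exceeds `s`, and `b` was chosen between `- t` and `q - (m + t)`.
  m ℚ.+ t , b ,
  subst (ℚ._< m ℚ.+ t) (solve 2 (λ s t → s :+ :- t :+ t := s) refl s t)
    (ℚ.+-monoˡ-< t s-t<m) ,
  subst (ℚ.- b ℚ.<_)
    (solve 2 (λ m t → :- (m :+ (:- m :+ :- t)) := t) refl m t)
    (ℚ.neg-antimono-< m-m-t<b) ,
  subst (m ℚ.+ t ℚ.+ b ℚ.<_)
    (solve 3 (λ m t q → m :+ t :+ (q :+ (:- m :+ :- t)) := q) refl m t q)
    (ℚ.+-monoʳ-< (m ℚ.+ t) b<q-m-t)
  where open +-*-Solver

-- Otherwise x * y < w by locatedness, so some rectangle around (x , y) has all
-- its products below w.
lower-* : ∀ x y {q w} → q ℚ.< w →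
          (∀ {a b c d} → lower x a → upper x b → lower y c → upper y d →
             ∃[ e ] ∃[ f ] In a b e × In c d f × w ℚ.≤ e ℚ.* f) →
          lower (x * y) q
lower-* x y {q} {w} q<w inside = cases (located (x * y) q<w)
  where
  cases : lower (x * y) q ⊎ upper (x * y) w → lower (x * y) q
  cases (inj₁ q<xy) = q<xy
  cases (inj₂ (a , b , c , d , a<x , x<b , c<y , y<d , h))
    with inside a<x x<b c<y y<d
  ... | e , f , (a≤e , e≤b) , (c≤f , f≤d) , w≤ef =
    ⊥-elim (ℚ.<-irrefl refl
      (ℚ.≤-<-trans w≤ef (inside-< {w} {a} {b} {c} {d} {e} {f} h a≤e e≤b c≤f f≤d)))

lower-fromℚ-* : ∀ s t {q} → q ℚ.< s ℚ.* t → lower (fromℚ s * fromℚ t) q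
lower-fromℚ-* s t q<st = lower-* (fromℚ s) (fromℚ t) q<st
  λ a<s s<b c<t t<d → s , t , (ℚ.<⇒≤ a<s , ℚ.<⇒≤ s<b) , (ℚ.<⇒≤ c<t , ℚ.<⇒≤ t<d) , ℚ.≤-refl

-- `δ` is the right end of the rectangle's side around `y`. The conclusion covers every `ν` between
-- `y` and `δ`, so that one `ν` can meet several such conditions.
upper-fromℚ-*⇒< : ∀ s y {u} → upper (fromℚ s * y) u →
                  ∃[ δ ] upper y δ × (∀ {ν} → upper y ν → ν ℚ.≤ δ → s ℚ.* ν ℚ.< u)
upper-fromℚ-*⇒< s y {u} (a , b , c , d , a<s , s<b , c<y , y<d , h) =
  d , y<d , λ y<ν ν≤d → inside-< {u} {a} {b} {c} {d} {s} h (ℚ.<⇒≤ a<s) (ℚ.<⇒≤ s<b)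
    (ℚ.<⇒≤ (lower<upper y c<y y<ν)) ν≤d

lower-fromℚ-*⇒< : ∀ s y {l} → lower (fromℚ s * y) l →
                  ∃[ δ ] upper y δ × (∀ {ν} → upper y ν → ν ℚ.≤ δ → l ℚ.< s ℚ.* ν)
lower-fromℚ-*⇒< s y {l} (a , b , c , d , a<s , s<b , c<y , y<d , h) =
  d , y<d , λ y<ν ν≤d → inside-> {l} {a} {b} {c} {d} {s} h (ℚ.<⇒≤ a<s) (ℚ.<⇒≤ s<b)
    (ℚ.<⇒≤ (lower<upper y c<y y<ν)) ν≤d

-- The embedding of the naturals in the rationals.

ι : ℕ → ℚ
ι n = + n ℚ./ 1

toℚᵘ-ι : ∀ n → ℚ.toℚᵘ (ι n) ℚᵘ.≃ ℚᵘ.mkℚᵘ (+ n) 0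
toℚᵘ-ι n = ℚ.toℚᵘ-fromℚᵘ (ℚᵘ.mkℚᵘ (+ n) 0)

ι-homo-+ : ∀ m n → ι (m ℕ.+ n) ≡ ι m ℚ.+ ι n
ι-homo-+ m n = ℚ.toℚᵘ-injective (ℚᵘ.≃-trans (toℚᵘ-ι (m ℕ.+ n)) (ℚᵘ.≃-sym
  (ℚᵘ.≃-trans (ℚ.toℚᵘ-homo-+ (ι m) (ι n))
    (ℚᵘ.≃-trans (ℚᵘ.+-cong (toℚᵘ-ι m) (toℚᵘ-ι n))
      (ℚᵘ.*≡* (cong (ℤ._* ℤ.1ℤ)
        (cong₂ ℤ._+_ (ℤ.*-identityʳ (+ m)) (ℤ.*-identityʳ (+ n)))))))))

ι-homo-* : ∀ m n → ι (m ℕ.* n) ≡ ι m ℚ.* ι n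
ι-homo-* m n = ℚ.toℚᵘ-injective (ℚᵘ.≃-trans (toℚᵘ-ι (m ℕ.* n)) (ℚᵘ.≃-sym
  (ℚᵘ.≃-trans (ℚ.toℚᵘ-homo-* (ι m) (ι n))
    (ℚᵘ.≃-trans (ℚᵘ.*-cong (toℚᵘ-ι m) (toℚᵘ-ι n))
      (ℚᵘ.*≡* (cong (ℤ._* ℤ.1ℤ) (sym (ℤ.pos-* m n))))))))

ι-mono-≤ : ∀ {m n} → m ℕ.≤ n → ι m ℚ.≤ ι n
ι-mono-≤ {m} {n} m≤n = ℚ.toℚᵘ-cancel-≤
  (ℚᵘ.≤-respˡ-≃ (ℚᵘ.≃-sym (toℚᵘ-ι m)) (ℚᵘ.≤-respʳ-≃ (ℚᵘ.≃-sym (toℚᵘ-ι n))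
    (ℚᵘ.*≤* (ℤ.*-monoʳ-≤-nonNeg ℤ.1ℤ (ℤ.+≤+ m≤n)))))

ι-mono-< : ∀ {m n} → m ℕ.< n → ι m ℚ.< ι n
ι-mono-< {m} {n} m<n = ℚ.toℚᵘ-cancel-<
  (ℚᵘ.<-respˡ-≃ (ℚᵘ.≃-sym (toℚᵘ-ι m)) (ℚᵘ.<-respʳ-≃ (ℚᵘ.≃-sym (toℚᵘ-ι n))
    (ℚᵘ.*<* (ℤ.*-monoʳ-<-pos ℤ.1ℤ (ℤ.+<+ m<n)))))

-- Lower bounds for (y + 1)/(2y) = 1/2 + 1/(2y).

-- Each rectangle around (y + 1 , 1/(2y)) contains a point (ν + 1 , 1/(2ν)) with
-- y < ν ≤ 1/t, whose product is ½ + 1/(2ν) ≥ ½ + t/2.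
lower-[y+1]/2y : ∀ y {{_ : Positive y}} {T t} →
  upper y T → t ℚ.* T ≡ 1ℚ → ∀ {q} → q ℚ.< ½ ℚ.+ ½ ℚ.* t →
  lower ((y + fromℕ 1) / (fromℕ 2 * y)) q
lower-[y+1]/2y y {T} {t} y<T tT≡1 q<w =
  lower-* (y + fromℕ 1) ((fromℕ 2 * y) ⁻¹) q<w point
  where
  open +-*-Solver
  point : ∀ {a b c d} → lower (y + fromℕ 1) a → upper (y + fromℕ 1) b →
    lower ((fromℕ 2 * y) ⁻¹) c → upper ((fromℕ 2 * y) ⁻¹) d →
    ∃[ e ] ∃[ f ] In a b e × In c d f × ½ ℚ.+ ½ ℚ.* t ℚ.≤ e ℚ.* f
  point {a} {b} {c} {d} (a₁ , a₂ , a₁<y , a₂<1 , a<a₁+a₂) (b₁ , b₂ , y<b₁ , 1<b₂ , b₁+b₂<b)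
        (u , 2y<u , cu<1) (l , 0<l , l<2y , 1<dl)
    with upper-fromℚ-*⇒< (ι 2) y 2y<u | lower-fromℚ-*⇒< (ι 2) y l<2y
  ... | δ , y<δ , 2ν<u-if | δ′ , y<δ′ , l<2ν-if = ν ℚ.+ 1ℚ , proj₁ inverse ,
    (ℚ.<⇒≤ a<ν+1 , ℚ.<⇒≤ ν+1<b) , (c≤f , f≤d) , w≤ef
    where
    -- `T` controls the product, `b₁` the first factor, and `δ`, `δ′` the reciprocal.
    ν = (T ℚ.⊓ b₁) ℚ.⊓ (δ ℚ.⊓ δ′)
    y<ν : upper y ν
    y<ν = upper-⊓ y (upper-⊓ y y<T y<b₁) (upper-⊓ y y<δ y<δ′)
    ν≤T : ν ℚ.≤ T
    ν≤T = ℚ.≤-trans (ℚ.p⊓q≤p _ _) (ℚ.p⊓q≤p T b₁)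
    0<ν = upper-positive y y<ν
    0<2ν = *-pos {ι 2} (ℚ.positive⁻¹ (ι 2)) 0<ν
    inverse = divide 1ℚ 0<2ν
    f = proj₁ inverse
    f[2ν]≡1 = proj₂ inverse
    0<f : 0ℚ ℚ.< f
    0<f = factor-pos 0<2ν f[2ν]≡1 0<1
    a<ν+1 : a ℚ.< ν ℚ.+ 1ℚ
    a<ν+1 = ℚ.<-trans a<a₁+a₂ (ℚ.+-mono-< (lower<upper y a₁<y y<ν) a₂<1)
    ν+1<b : ν ℚ.+ 1ℚ ℚ.< b
    ν+1<b = ℚ.<-trans (ℚ.+-mono-≤-< (ℚ.≤-trans (ℚ.p⊓q≤p _ _) (ℚ.p⊓q≤q T b₁)) 1<b₂) b₁+b₂<b
    2ν<u : ι 2 ℚ.* ν ℚ.< u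
    2ν<u = 2ν<u-if y<ν (ℚ.≤-trans (ℚ.p⊓q≤q (T ℚ.⊓ b₁) _) (ℚ.p⊓q≤p δ δ′))
    l<2ν : l ℚ.< ι 2 ℚ.* ν
    l<2ν = l<2ν-if y<ν (ℚ.≤-trans (ℚ.p⊓q≤q (T ℚ.⊓ b₁) _) (ℚ.p⊓q≤q δ δ′))
    c≤f : c ℚ.≤ f
    c≤f = ℚ.≮⇒≥ λ f<c → ℚ.<-asym cu<1
      (subst (ℚ._< c ℚ.* u) f[2ν]≡1
        (ℚ.<-trans (*-monoˡ 0<2ν f<c) (*-monoʳ (ℚ.<-trans 0<f f<c) 2ν<u)))
    f≤d : f ℚ.≤ d
    f≤d = ℚ.≮⇒≥ λ d<f → ℚ.<-asym 1<dl
      (ℚ.<-trans (*-monoˡ 0<l d<f) (subst (f ℚ.* l ℚ.<_) f[2ν]≡1 (*-monoʳ 0<f l<2ν)))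
    0<T = upper-positive y y<T
    t≤2f : t ℚ.≤ f ℚ.* ι 2
    t≤2f = ℚ.≮⇒≥ λ 2f<t → ℚ.<-irrefl (trans eq (sym tT≡1))
      (ℚ.≤-<-trans (ℚ.*-monoˡ-≤-nonNeg (f ℚ.* ι 2)
         {{nonNegative (ℚ.<⇒≤ (*-pos 0<f (ℚ.positive⁻¹ (ι 2))))}} ν≤T)
        (*-monoˡ 0<T 2f<t))
      where
      eq : f ℚ.* ι 2 ℚ.* ν ≡ 1ℚ
      eq = trans (ℚ.*-assoc f (ι 2) ν) f[2ν]≡1
    w≤ef : ½ ℚ.+ ½ ℚ.* t ℚ.≤ (ν ℚ.+ 1ℚ) ℚ.* f
    w≤ef = begin
      ½ ℚ.+ ½ ℚ.* t                            ≤⟨ ℚ.+-monoʳ-≤ ½ (ℚ.*-monoˡ-≤-nonNeg ½ t≤2f) ⟩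
      ½ ℚ.+ ½ ℚ.* (f ℚ.* ι 2)                  ≡⟨ cong (λ z → ½ ℚ.* z ℚ.+ ½ ℚ.* (f ℚ.* ι 2)) f[2ν]≡1 ⟨
      ½ ℚ.* (f ℚ.* (ι 2 ℚ.* ν)) ℚ.+ ½ ℚ.* (f ℚ.* ι 2)
        ≡⟨ solve 2 (λ f ν → con ½ :* (f :* (con (ι 2) :* ν)) :+ con ½ :* (f :* con (ι 2))
             := (ν :+ con 1ℚ) :* f) refl f ν ⟩
      (ν ℚ.+ 1ℚ) ℚ.* f                         ∎
      where open ℚ.≤-Reasoning

reciprocal-antimono-< : ∀ {t T t′ T′} → 0ℚ ℚ.< t → 0ℚ ℚ.< T′ → t ℚ.* T ≡ 1ℚ → t′ ℚ.* T′ ≡ 1ℚ →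
                        T′ ℚ.< T → t ℚ.< t′
reciprocal-antimono-< 0<t 0<T′ tT≡1 t′T′≡1 T′<T =
  *-cancelʳ 0<T′ (subst (_ ℚ.<_) (trans tT≡1 (sym t′T′≡1)) (*-monoʳ 0<t T′<T))

-- Rounding `T` down inside the upper cut raises its reciprocal above `t`, which gives the strict
-- inequality that `lower-[y+1]/2y` asks for.
lower-½+t/2 : ∀ y {{_ : Positive y}} {T t} → upper y T → t ℚ.* T ≡ 1ℚ → 0ℚ ℚ.< t →
              lower ((y + fromℕ 1) / (fromℕ 2 * y)) (½ ℚ.+ ½ ℚ.* t)
lower-½+t/2 y {T} {t} y<T tT≡1 0<t =
  let T′ , T′<T , y<T′ = upper-rounded y y<T
      0<T′ = upper-positive y y<T′
      t′ , t′T′≡1 = divide 1ℚ 0<T′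
  in lower-[y+1]/2y y {T′} {t′} y<T′ t′T′≡1
       (ℚ.+-monoʳ-< ½ (*-monoʳ (ℚ.positive⁻¹ ½)
         (reciprocal-antimono-< {t} {T} {t′} {T′} 0<t 0<T′ tT≡1 t′T′≡1 T′<T)))

-- From the integer bound to the inequality of reals.

linearPart : ℕ → ℝ
linearPart p = fromℕ 2 * fromℕ p - √ (fromℕ p - fromℚ (+ 3 ℚ./ 4))

ratioPart : (N : ℕ) {{_ : ℚ.Positive (ι N)}} → ℝ
ratioPart N = (√ fromℕ N + fromℕ 1) / (fromℕ 2 * √ fromℕ N)

bound : (N p : ℕ) {{_ : ℚ.Positive (ι N)}} → ℝ
bound N p = linearPart p + ratioPart N

module _ (N B p D a : ℕ) (B+D≡2p : B ℕ.+ D ≡ 2 ℕ.* p)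
         (p≤ : p ℕ.≤ D ℕ.* D ℕ.+ D ℕ.+ 1 ℕ.+ a)
         (N[2a+1]²<[2D+1]² : N ℕ.* ((2 ℕ.* a ℕ.+ 1) ℕ.* (2 ℕ.* a ℕ.+ 1)) ℕ.<
                             (2 ℕ.* D ℕ.+ 1) ℕ.* (2 ℕ.* D ℕ.+ 1)) where
  open +-*-Solver

  x c : ℕ
  x = 2 ℕ.* D ℕ.+ 1
  c = 2 ℕ.* a ℕ.+ 1

  X C : ℚ
  X = ι x
  C = ι c

  0<X : 0ℚ ℚ.< X
  0<X = ι-mono-< (ℕ.≤-trans (ℕ.s≤s ℕ.z≤n) (ℕ.m≤n+m 1 (2 ℕ.* D)))

  0<C : 0ℚ ℚ.< C
  0<C = ι-mono-< (ℕ.≤-trans (ℕ.s≤s ℕ.z≤n) (ℕ.m≤n+m 1 (2 ℕ.* a)))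

  NC²<X² : ι N ℚ.* (C ℚ.* C) ℚ.< X ℚ.* X
  NC²<X² = subst₂ ℚ._<_
    (trans (ι-homo-* N (c ℕ.* c)) (cong (ι N ℚ.*_) (ι-homo-* c c))) (ι-homo-* x x)
    (ι-mono-< N[2a+1]²<[2D+1]²)

  4p≤X²+2C+1 : ι 4 ℚ.* ι p ℚ.≤ X ℚ.* X ℚ.+ ι 2 ℚ.* C ℚ.+ 1ℚ
  4p≤X²+2C+1 = subst₂ ℚ._≤_ (ι-homo-* 4 p)
    (trans (ι-homo-+ (x ℕ.* x ℕ.+ 2 ℕ.* c) 1) (cong (ℚ._+ 1ℚ)
      (trans (ι-homo-+ (x ℕ.* x) (2 ℕ.* c)) (cong₂ ℚ._+_ (ι-homo-* x x) (ι-homo-* 2 c)))))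
    (ι-mono-≤ (ℕ.≤-trans (ℕ.*-monoʳ-≤ 4 p≤) (ℕ.≤-reflexive (eq D a))))
    where
    eq : ∀ D a → 4 ℕ.* (D ℕ.* D ℕ.+ D ℕ.+ 1 ℕ.+ a) ≡
      (2 ℕ.* D ℕ.+ 1) ℕ.* (2 ℕ.* D ℕ.+ 1) ℕ.+ 2 ℕ.* (2 ℕ.* a ℕ.+ 1) ℕ.+ 1
    eq = solve-∀

  X≡2D+1 : X ≡ ι 2 ℚ.* ι D ℚ.+ 1ℚ
  X≡2D+1 = trans (ι-homo-+ (2 ℕ.* D) 1) (cong (ℚ._+ 1ℚ) (ι-homo-* 2 D))

  ιB+ιD≡2p : ι B ℚ.+ ι D ≡ ι 2 ℚ.* ι p
  ιB+ιD≡2p = trans (sym (ι-homo-+ B D)) (trans (cong ι B+D≡2p) (ι-homo-* 2 p))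

  module _ {t : ℚ} (tX≡C : t ℚ.* X ≡ C) where
    0<t : 0ℚ ℚ.< t
    0<t = factor-pos 0<X tX≡C 0<C

    Nt²<1 : ι N ℚ.* (t ℚ.* t) ℚ.< 1ℚ
    Nt²<1 = *-cancelʳ (*-pos 0<X 0<X) (subst₂ ℚ._<_ eq (sym (ℚ.*-identityˡ (X ℚ.* X))) NC²<X²)
      where
      eq : ι N ℚ.* (C ℚ.* C) ≡ ι N ℚ.* (t ℚ.* t) ℚ.* (X ℚ.* X)
      eq = trans (cong (λ z → ι N ℚ.* (z ℚ.* z)) (sym tX≡C))
        (solve 3 (λ N t X → N :* (t :* X :* (t :* X)) := N :* (t :* t) :* (X :* X)) refl (ι N) t X)

    √N<1/t : ∀ {T} → T ℚ.* t ≡ 1ℚ → upper (√ fromℕ N) T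
    √N<1/t {T} Tt≡1 = 0<T , *-cancelʳ (*-pos 0<t 0<t) (subst (ι N ℚ.* (t ℚ.* t) ℚ.<_) eq Nt²<1)
      where
      0<T : 0ℚ ℚ.< T
      0<T = factor-pos 0<t Tt≡1 0<1
      eq : 1ℚ ≡ T ℚ.* T ℚ.* (t ℚ.* t)
      eq = trans (cong₂ ℚ._*_ (sym Tt≡1) (sym Tt≡1))
        (solve 2 (λ T t → T :* t :* (T :* t) := T :* T :* (t :* t)) refl T t)

    Y : ℚ
    Y = ½ ℚ.* (X ℚ.+ t)

    -- Since `C = tX`, `4p - 3 ≤ X² + 2tX - 2`, which is `t² + 2` short of `(X + t)² = 4Y²`. A
    -- quarter of that is the slack added below.
    p-¾<Y² : ι p ℚ.- (+ 3 ℚ./ 4) ℚ.< Y ℚ.* Y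
    p-¾<Y² = begin-strict
      ι p ℚ.- (+ 3 ℚ./ 4)
        ≡⟨ solve 1 (λ p → p :+ (:- con (+ 3 ℚ./ 4)) :=
             con (+ 1 ℚ./ 4) :* (con (ι 4) :* p) :+ con (-[1+ 2 ] ℚ./ 4)) refl (ι p) ⟩
      (+ 1 ℚ./ 4) ℚ.* (ι 4 ℚ.* ι p) ℚ.+ (-[1+ 2 ] ℚ./ 4)
        ≤⟨ ℚ.+-monoˡ-≤ (-[1+ 2 ] ℚ./ 4) (ℚ.*-monoˡ-≤-nonNeg (+ 1 ℚ./ 4) 4p≤X²+2C+1) ⟩
      (+ 1 ℚ./ 4) ℚ.* (X ℚ.* X ℚ.+ ι 2 ℚ.* C ℚ.+ 1ℚ) ℚ.+ (-[1+ 2 ] ℚ./ 4)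
        ≡⟨ cong (λ z → (+ 1 ℚ./ 4) ℚ.* (X ℚ.* X ℚ.+ ι 2 ℚ.* z ℚ.+ 1ℚ) ℚ.+ (-[1+ 2 ] ℚ./ 4)) tX≡C ⟨
      (+ 1 ℚ./ 4) ℚ.* (X ℚ.* X ℚ.+ ι 2 ℚ.* (t ℚ.* X) ℚ.+ 1ℚ) ℚ.+ (-[1+ 2 ] ℚ./ 4)
        <⟨ p<p+q _ (ℚ.+-mono-< {0ℚ} {½} {0ℚ} (ℚ.positive⁻¹ ½)
             (*-pos {½ ℚ.* t} (0<½* 0<t) (0<½* 0<t))) ⟩
      (+ 1 ℚ./ 4) ℚ.* (X ℚ.* X ℚ.+ ι 2 ℚ.* (t ℚ.* X) ℚ.+ 1ℚ) ℚ.+ (-[1+ 2 ] ℚ./ 4)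
        ℚ.+ (½ ℚ.+ ½ ℚ.* t ℚ.* (½ ℚ.* t))
        ≡⟨ solve 2 (λ t X →
             con (+ 1 ℚ./ 4) :* (X :* X :+ con (ι 2) :* (t :* X) :+ con 1ℚ) :+ con (-[1+ 2 ] ℚ./ 4)
               :+ (con ½ :+ con ½ :* t :* (con ½ :* t))
             := con ½ :* (X :+ t) :* (con ½ :* (X :+ t))) refl t X ⟩
      Y ℚ.* Y ∎
      where open ℚ.≤-Reasoning

    -- The lower bounds `2p - Y` for `linearPart` and `½ + ½t` for `ratioPart` add up exactly to
    -- `B`: the terms in `t` cancel and `X = 2D + 1` leaves `2p - D`.
    sum≡B : ι 2 ℚ.* ι p ℚ.- Y ℚ.+ (½ ℚ.+ ½ ℚ.* t) ≡ ι B
    sum≡B = begin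
      ι 2 ℚ.* ι p ℚ.- Y ℚ.+ (½ ℚ.+ ½ ℚ.* t)
        ≡⟨ cong₂ (λ z X → z ℚ.- ½ ℚ.* (X ℚ.+ t) ℚ.+ (½ ℚ.+ ½ ℚ.* t)) (sym ιB+ιD≡2p) X≡2D+1 ⟩
      ι B ℚ.+ ι D ℚ.- ½ ℚ.* (ι 2 ℚ.* ι D ℚ.+ 1ℚ ℚ.+ t) ℚ.+ (½ ℚ.+ ½ ℚ.* t)
        ≡⟨ solve 3 (λ B D t → B :+ D :+ (:- (con ½ :* (con (ι 2) :* D :+ con 1ℚ :+ t)))
             :+ (con ½ :+ con ½ :* t) := B) refl (ι B) (ι D) t ⟩
      ι B ∎
      where open ≡-Reasoning

    lower-B : {{_ : ℚ.Positive (ι N)}} → lower (bound N p) (ι B)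
    lower-B =
      let T , Tt≡1 = divide 1ℚ 0<t in
      subst (lower (bound N p)) sum≡B (lower-+ (linearPart p) (ratioPart N)
        (lower-- (fromℕ 2 * fromℕ p) (√ (fromℕ p - fromℚ (+ 3 ℚ./ 4)))
          (lower-fromℚ-* (ι 2) (ι p)) (0<Y , upper-fromℚ-- {ι p} p-¾<Y²))
        (lower-½+t/2 (√ fromℕ N) {T} {t} (√N<1/t Tt≡1) (trans (ℚ.*-comm t T) Tt≡1) 0<t))
      where
      0<Y : 0ℚ ℚ.< Y
      0<Y = 0<½* (+-pos 0<X 0<t)

  -- Roundedness of the lower cut turns membership of `ι B` into strict inequality.
  B<bound : {{_ : ℚ.Positive (ι N)}} → fromℕ B < bound N p
  B<bound = let t , tX≡C = divide C 0<X in lower-rounded (bound N p) (lower-B {t} tX≡C)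

Bound⇒< : ∀ {N B p} {{_ : ℚ.Positive (ι N)}} → Bound N B p → fromℕ B < bound N p
Bound⇒< {N} {B} {p} (D , a , B+D≡2p , p≤ , N[2a+1]²<) =
  B<bound N B p D a B+D≡2p p≤ N[2a+1]²<

theorem4p3 :
  (∀ {n p q r} → K₃N n p q r →
    fromℕ (B p q r) <
      fromℕ 2 * fromℕ p - √ (fromℕ p - fromℚ (+ 3 ℚ./ 4))
        + (√ (fromℕ 3) + fromℕ 1) / (fromℕ 2 * √ (fromℕ 3)))
  ×
  (∀ {n p q r} → C₃N n p q r →
    fromℕ (B p q r) <
      fromℕ 2 * fromℕ p - √ (fromℕ p - fromℚ (+ 3 ℚ./ 4))
        + (√ (fromℕ 7) + fromℕ 1) / (fromℕ 2 * √ (fromℕ 7)))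
theorem4p3 = (λ k → Bound⇒< {3} (K₃N⇒bound k)) , (λ c → Bound⇒< {7} (C₃N⇒bound c))
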